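{- For every positive integer $n$, the map $\Phi$ defined below is a bijection $\Phi:\mathcal O(n)\to\mathcal D(n)$ which extends Bressoud's map $B$ (i.e. $\Phi(\lambda)=B(\lambda)$ for $\lambda\in\mathcal O(n)\cap\mathcal D(n)$), and for every $\lambda\in\mathcal O(n)$, $$|\Phi(\lambda)|_a=\ell(\lambda)\qquad\text{and}\qquad \ell_o(\Phi(\lambda))=n_o(\lambda).$$
   Context: A partition $\lambda$ of $n$ is a non-increasing sequence $\lambda=(\lambda_1,\dots,\lambda_\ell)$ of positive integers with sum $n$; $\ell(\lambda)=\ell$ is its length, and by convention $\lambda_j=0$ for $j>\ell$. $\mathcal O(n)$ is the set of partitions of $n$ all of whose parts are odd; $\mathcal D(n)$ is the set of partitions of $n$ with distinct parts. The alternating sum is $|\lambda|_a=\sum_{j=1}^{\ell}(-1)^{j-1}\lambda_j$; $\ell_o(\lambda)$ is the number of odd parts of $\lambda$; $m_i(\lambda)$ is the multiplicity of $i$ as a part of $\lambda$; $n_o(\lambda)$ is the number of $i>0$ with $m_i(\lambda)$ odd. For partitions $\alpha,\beta$, $\alpha\circ\beta$ is the partition whose parts are all parts of $\alpha$ and of $\beta$ (with multiplicity) in non-increasing order, and $\alpha^2=\alpha\circ\alpha$. Bressoud's map $B$ on $\mathcal O(n)\cap\mathcal D(n)$: let $\beta\in\mathcal O(n)\cap\mathcal D(n)$. Decompose the parts of $\beta$ into its runs (maximal sequences of consecutive odd integers all occurring as parts of $\beta$). For a run $2m-1>2m-3>\dots>2m-2k+1$, form pairs $(2m-1,2m-3),(2m-5,2m-7),\dots$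 starting from the largest term; if $k$ is odd, the remaining smallest term $c=2m-2k+1$ is replaced by the pair $(\frac{c+1}{2},\frac{c-1}{2})$. Let $\pi=(\pi_1,\dots,\pi_{2s})$ be the concatenation of all these pairs, runs in decreasing order and pairs within a run in the order formed; the pairs of $\pi$ are $(\pi_{2j-1},\pi_{2j})$. A pair interchange: if $(\pi_{2j-1},\pi_{2j})=(a+1,a)$ and $(\pi_{2j+1},\pi_{2j+2})=(2b+1,2b-1)$ with $a\le 2b+1$, replace these four entries by $(2b+3,2b+1,a-1,a-2)$. Starting from $\pi$, repeatedly perform pair interchanges (each time the leftmost available one) until none is possible, then delete zero entries; the result is $B(\beta)$ (for $\beta$ empty, $B(\beta)$ is empty). Insertion: for a partition $\gamma$ (with $\gamma_k=0$ for $k>\ell(\gamma)$) and an integer $a\ge1$, define $I_a(\gamma)$ (the insertion of the pair $(2a-1)^2$) as follows. For $j=0,1,2,\dots$ in turn: if $j=a-1$, set $I_a(\gamma)=(\gamma_1+2,\dots,\gamma_{2j}+2,\gamma_{2j+1}+2,\gamma_{2j+2},\gamma_{2j+3},\dots)$ and stop; otherwise, if $2a-2j-2>\gamma_{2j+1}$, set $I_a(\gamma)=(\gamma_1+2,\dots,\gamma_{2j}+2,\,2a-2j,\,2a-2j-2,\,\gamma_{2j+1},\gamma_{2j+2},\dots)$ and stop; otherwise pass to $j+1$. Zero entries are discarded. The map $\Phi$: for $\lambda\in\mathcal O(n)$ write uniquely $\lambda=\alpha^2\circ\beta$ with $\beta$ having distinct parts (so $\beta$ consists of the parts $i$ with $m_i(\lambda)$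 odd, each once, and $\alpha$ contains each $i$ with multiplicity $\lfloor m_i(\lambda)/2\rfloor$). Let $t=\ell(\alpha)$ and $\alpha_i=2a_i-1$ for $i=1,\dots,t$ (with $\alpha_1\ge\dots\ge\alpha_t$). Set $\gamma^{(0)}=B(\beta)$ and $\gamma^{(i)}=I_{a_i}(\gamma^{(i-1)})$ for $i=1,\dots,t$, and define $\Phi(\lambda)=\gamma^{(t)}$. -}

module Defs where

open import Data.Bool.Base using (true; false; if_then_else_)
open import Data.Integer.Base as ℤ using (ℤ; +_)
open import Data.List.Base using
  (List; []; _∷_; length; filter; deduplicate; replicate; concatMap; foldl; foldr; drop)
open import Data.List.Relation.Unary.All using (All)
open import Data.List.Relation.Unary.Linked using (Linked)
open import Data.List.Relation.Unary.Unique.Propositional using (Unique)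
open import Data.Maybe.Base as Maybe using (Maybe; just; nothing)
open import Data.Nat.Base using
  (ℕ; zero; suc; _+_; _*_; _∸_; _≤_; _<_; _≥_; s≤s⁻¹; ⌊_/2⌋; ⌈_/2⌉)
open import Data.Nat.DivMod using (_%_)
open import Data.Nat.ListAction using (sum)
open import Data.Nat.Properties using
  (_≟_; _≤?_; _<?_; ≤-refl; ≤-trans; ≤-reflexive; +-mono-≤-<)
open import Data.Product.Base using (_×_; _,_)
open import Level using (0ℓ)
open import Relation.Binary.PropositionalEquality using (_≡_; refl; cong)
open import Relation.Nullary.Decidable using (does)
open import Relation.Unary using (Pred; Decidable)

------------------------------------------------------------------------
-- Partitions

Odd : Pred ℕ 0ℓ
Odd k = k % 2 ≡ 1

odd? : Decidable Odd
odd? k = k % 2 ≟ 1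

record IsPartition (n : ℕ) (p : List ℕ) : Set where
  field
    nonIncreasing : Linked _≥_ p
    positive      : All (0 <_) p
    total         : sum p ≡ n

𝒪 : ℕ → Pred (List ℕ) 0ℓ
𝒪 n p = IsPartition n p × All Odd p

𝒟 : ℕ → Pred (List ℕ) 0ℓ
𝒟 n p = IsPartition n p × Unique p

-- p₁ − p₂ + p₃ − … , computed as p₁ − (p₂ − (p₃ − …)).
altSum : List ℕ → ℤ
altSum []      = + 0
altSum (x ∷ p) = + x ℤ.- altSum p

ℓₒ : List ℕ → ℕ
ℓₒ p = length (filter odd? p)

mult : ℕ → List ℕ → ℕ
mult i p = length (filter (i ≟_) p)

-- The i with mult i p odd, each once, in the order of p.  Such an i occurs
-- in p, so it suffices to look among the values of the parts.
oddMultParts : List ℕ → List ℕ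
oddMultParts p = filter (λ i → odd? (mult i p)) (deduplicate _≟_ p)

nₒ : List ℕ → ℕ
nₒ p = length (oddMultParts p)

-- The α of the decomposition p = α² ∘ β; the β is oddMultParts p.
halfMultParts : List ℕ → List ℕ
halfMultParts p = concatMap (λ i → replicate ⌊ mult i p /2⌋ i) (deduplicate _≟_ p)

-- p_{k+1}, with the convention that it is 0 beyond the length of p.
part : ℕ → List ℕ → ℕ
part k       []      = 0
part zero    (x ∷ p) = x
part (suc k) (x ∷ p) = part k p

------------------------------------------------------------------------
-- Bressoud's map

-- Only two shapes of pairs (π_{2j-1} , π_{2j}) ever occur:
-- close a is (a + 1 , a) and wide b is (2b + 1 , 2b − 1).
data Pair : Set where
  close : ℕ → Pair
  wide  : ℕ → Pair

entries : Pair → List ℕ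
entries (close a) = a + 1 ∷ a ∷ []
entries (wide b)  = 2 * b + 1 ∷ 2 * b ∸ 1 ∷ []

consRun : ℕ → List (List ℕ) → List (List ℕ)
consRun x ((y ∷ r) ∷ rs) =
  if does (x ≟ y + 2) then (x ∷ y ∷ r) ∷ rs else (x ∷ []) ∷ (y ∷ r) ∷ rs
consRun x rs             = (x ∷ []) ∷ rs

-- The maximal blocks of consecutive entries with successive differences 2.
runs : List ℕ → List (List ℕ)
runs = foldr consRun []

-- On a run x > x − 2 > … of odd integers: (x , x − 2) is wide ⌊ x /2⌋, and
-- ((c + 1) / 2 , (c − 1) / 2) is close ⌊ c /2⌋.
runPairs : List ℕ → List Pair
runPairs []          = []
runPairs (c ∷ [])    = close ⌊ c /2⌋ ∷ []
runPairs (x ∷ _ ∷ r) = wide ⌊ x /2⌋ ∷ runPairs r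

initialPairs : List ℕ → List Pair
initialPairs β = concatMap runPairs (runs β)

-- (a + 1 , a , 2b + 1 , 2b − 1) ↦ (2b + 3 , 2b + 1 , a − 1 , a − 2) if a ≤ 2b + 1.
-- The subtraction is never truncated in the computation of bressoud β for
-- β with distinct odd parts: if k wide pairs stand to the right of the initial
-- close ⌊ c /2⌋, then their 2k distinct odd entries are at most c − 4, so
-- c ≥ 4k + 3 and a ≥ 2k + 1; each interchange lowers a by 2 and k by 1.
interchange : Pair → Pair → Maybe (Pair × Pair)
interchange (close a) (wide b) =
  if does (a ≤? 2 * b + 1) then just (wide (b + 1) , close (a ∸ 2)) else nothing
interchange _ _ = nothing

-- The leftmost available interchange.
step : List Pair → Maybe (List Pair)
step []           = nothing
step (_ ∷ [])     = nothing
step (p ∷ qs@(q ∷ ps)) =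
  Maybe.maybe′ (λ (q′ , p′) → just (q′ ∷ p′ ∷ ps)) (Maybe.map (p ∷_) (step qs)) (interchange p q)

stepUpTo : ℕ → List Pair → List Pair
stepUpTo zero    ps = ps
stepUpTo (suc m) ps with step ps
... | just qs = stepUpTo m qs
... | nothing = ps

wides : List Pair → ℕ
wides []             = 0
wides (close _ ∷ ps) = wides ps
wides (wide _ ∷ ps)  = 1 + wides ps

-- The number of (close, wide) inversions, which every interchange decreases;
-- it is therefore a bound on the number of interchanges (normalise-normal).
inversions : List Pair → ℕ
inversions []             = 0
inversions (close _ ∷ ps) = wides ps + inversions ps
inversions (wide _ ∷ ps)  = inversions ps

normalise : List Pair → List Pair
normalise ps = stepUpTo (inversions ps) ps

bressoud : List ℕ → List ℕ
bressoud β = filter (0 <?_) (concatMap entries (normalise (initialPairs β)))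

step-wides : ∀ ps {qs} → step ps ≡ just qs → wides qs ≡ wides ps
step-wides (close a ∷ wide b ∷ ps) eq with does (a ≤? 2 * b + 1)
step-wides (close a ∷ wide b ∷ ps) refl | true = refl
step-wides (close a ∷ wide b ∷ ps) eq   | false
  with step (wide b ∷ ps) in eq′
step-wides (close a ∷ wide b ∷ ps) refl | false | just _ =
  step-wides (wide b ∷ ps) eq′
step-wides (close a ∷ close b ∷ ps) eq with step (close b ∷ ps) in eq′
step-wides (close a ∷ close b ∷ ps) refl | just _ = step-wides (close b ∷ ps) eq′
step-wides (wide a ∷ q ∷ ps) eq with step (q ∷ ps) in eq′
step-wides (wide a ∷ q ∷ ps) refl | just _ = cong suc (step-wides (q ∷ ps) eq′)

step-inversions : ∀ ps {qs} → step ps ≡ just qs → inversions qs < inversions ps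
step-inversions (close a ∷ wide b ∷ ps) eq with does (a ≤? 2 * b + 1)
step-inversions (close a ∷ wide b ∷ ps) refl | true = ≤-refl
step-inversions (close a ∷ wide b ∷ ps) eq   | false
  with step (wide b ∷ ps) in eq′
step-inversions (close a ∷ wide b ∷ ps) refl | false | just _ =
  +-mono-≤-< (≤-reflexive (step-wides (wide b ∷ ps) eq′)) (step-inversions (wide b ∷ ps) eq′)
step-inversions (close a ∷ close b ∷ ps) eq with step (close b ∷ ps) in eq′
step-inversions (close a ∷ close b ∷ ps) refl | just _ =
  +-mono-≤-< (≤-reflexive (step-wides (close b ∷ ps) eq′)) (step-inversions (close b ∷ ps) eq′)
step-inversions (wide a ∷ q ∷ ps) eq with step (q ∷ ps) in eq′
step-inversions (wide a ∷ q ∷ ps) refl | just _ = step-inversions (q ∷ ps) eq′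

stepUpTo-normal : ∀ m ps → inversions ps ≤ m → step (stepUpTo m ps) ≡ nothing
stepUpTo-normal zero ps i≤m with step ps in eq
... | nothing = refl
... | just qs with () ← ≤-trans (step-inversions ps eq) i≤m
stepUpTo-normal (suc m) ps i≤m with step ps in eq
... | nothing = eq
... | just qs = stepUpTo-normal m qs (s≤s⁻¹ (≤-trans (step-inversions ps eq) i≤m))

normalise-normal : ∀ ps → step (normalise ps) ≡ nothing
normalise-normal ps = stepUpTo-normal (inversions ps) ps ≤-refl

------------------------------------------------------------------------
-- Insertion and the map Φ

-- insertAt d γ is the procedure from the j-th stage on, where d = a − 1 − j
-- and γ = (γ_{2j+1} , γ_{2j+2} , …).  It creates no zero entries.
insertAt : ℕ → List ℕ → List ℕ
insertAt zero      γ = part 0 γ + 2 ∷ drop 1 γ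
insertAt d@(suc e) γ =
  if does (part 0 γ <? 2 * d)
  then 2 * d + 2 ∷ 2 * d ∷ γ
  else part 0 γ + 2 ∷ part 1 γ + 2 ∷ insertAt e (drop 2 γ)

-- I_a(γ), for a ≥ 1.
insert : ℕ → List ℕ → List ℕ
insert a γ = insertAt (a ∸ 1) γ

-- For odd x, x = 2a − 1 with a = ⌈ x /2⌉.
Φ : List ℕ → List ℕ
Φ p = foldl (λ γ x → insert ⌈ x /2⌉ γ) (bressoud (oddMultParts p)) (halfMultParts p)

{-# OPTIONS --safe #-}
module Submission where

-- Group a partition γ into the pairs (γ₁ , γ₂), (γ₃ , γ₄), …
--
-- Insertion.  In I_a(γ) the insertion is visible either as a pair (2e + 2 , 2e) at place j, with
-- a = e + 1 + j, or as a pair at place j whose gap is at least 3, with a = j + 1 (places count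
-- from 0; the pair (2 , 0) at the end is of the first kind).  Conversely every such place can be
-- undone.  If all the values a readable off γ in this way are at least a₀, then the same holds for
-- I_{a₀}(γ), from which a₀ can be read off; so a₀ is the least such value there, and since it
-- determines its place, the last of a non-increasing sequence of insertions can be recovered.  The
-- partitions off which nothing can be read are those whose pairs are (a + 1 , a) or
-- (2b + 1 , 2b − 1): the image of Bressoud's map.
--
-- Bressoud's map.  Give the pairs (a + 1 , a) and (2b + 1 , 2b − 1) the indices a and b.  Runs of
-- distinct odd parts correspond to lists of pairs with indices dropping by at least 2.  The
-- interchanges can be performed from right to left: each pair (a + 1 , a) slides to the right into
-- the settled rest.  A slide is injective, and whether the first pair of the original list was
-- of the form (a + 1 , a) is visible in the settled list: it was so precisely if the first such
-- pair can slide back to the front with all indices still dropping by at least 2.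

open import Defs
open import Data.Bool.Base using (true; false; T)
open import Data.Empty using (⊥-elim)
open import Data.Integer.Base as ℤ using (+_)
import Data.Integer.Properties as ℤ
import Data.Integer.Tactic.RingSolver as ℤSolver
open import Data.List.Base using
  (List; []; _∷_; length; map; concatMap; filter; replicate; deduplicate; drop; foldl; foldr; reverse; _++_)
open import Data.List.Properties using
  (∷-injective; ∷-injectiveˡ; ∷-injectiveʳ; filter-accept; filter-reject; filter-none; filter-++;
   length-++; length-map; length-reverse; reverse-foldl; reverse-involutive; unfold-reverse)
open import Data.List.Relation.Binary.Permutation.Propositional using (_↭_; ↭-sym)
open import Data.List.Relation.Binary.Permutation.Propositional.Properties using
  (filter-↭; ↭-length; ↭-reverse; All-resp-↭; map⁺)
open import Data.List.Relation.Unary.All as All using (All; []; _∷_)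
import Data.List.Relation.Unary.All.Properties as All
open import Data.List.Relation.Unary.AllPairs as AllPairs using (AllPairs; []; _∷_)
import Data.List.Relation.Unary.AllPairs.Properties as AllPairs
open import Data.List.Relation.Unary.Linked as Linked using (Linked; []; [-]; _∷_)
open import Data.List.Relation.Unary.Linked.Properties using (Linked⇒AllPairs; AllPairs⇒Linked)
import Data.List.Sort as Sort
open import Data.Maybe.Base using (just; nothing)
open import Data.Nat.Base
open import Data.Nat.DivMod using (_%_)
open import Data.Nat.Induction using (<-wellFounded)
open import Data.Nat.ListAction using (sum)
open import Data.Nat.ListAction.Properties using (sum-↭; sum-++)
open import Data.Nat.Properties
open import Data.Nat.Tactic.RingSolver using (solve-∀)
open import Data.Product.Base using (Σ-syntax; ∃; ∃₂; _×_; _,_; proj₁; proj₂)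
open import Data.Sum.Base using (_⊎_; inj₁; inj₂)
open import Data.Unit.Base using (⊤; tt)
open import Function.Base using (_∘_; flip; _on_)
open import Function.Definitions using (Bijective)
open import Induction.WellFounded using (Acc; acc)
open import Level using (0ℓ)
open import Relation.Binary.PropositionalEquality
import Relation.Binary.Construct.Flip.EqAndOrd as Flip
open import Relation.Nullary using (¬_; Dec; yes; no; contradiction; does; ¬?)
open import Relation.Nullary.Decidable using (dec-true; dec-false)
open import Relation.Unary using (Pred; _∈_)

-- Insertion on lists of pairs

Rows : Set
Rows = List (ℕ × ℕ)

private variable
  a b d e i j m n x y : ℕ
  ds ks xs ys : List ℕ
  p : ℕ × ℕ
  ps qs rs : Rows
  π ρ σ : List Pair

-- Doubling by recursion exposes two successors at a time, so inequalities and parities of entries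
-- can be matched on; `double≡2*` links it to the `2 *` of the procedures.
double : ℕ → ℕ
double zero    = zero
double (suc n) = suc (suc (double n))

double-mono : ∀ {m n} → m ≤ n → double m ≤ double n
double-mono z≤n       = z≤n
double-mono (s≤s m≤n) = s≤s (s≤s (double-mono m≤n))

double-cancel : ∀ {m n} → double m ≤ suc (double n) → m ≤ n
double-cancel {zero}          p             = z≤n
double-cancel {suc m} {suc n} (s≤s (s≤s p)) = s≤s (double-cancel p)
double-cancel {suc m} {zero}  (s≤s ())

double-injective : ∀ {m n} → double m ≡ double n → m ≡ n
double-injective {zero}  {zero}  eq = refl
double-injective {suc m} {suc n} eq = cong suc (double-injective (suc-injective (suc-injective eq)))

double≢suc-double : ∀ m n → double m ≢ suc (double n)
double≢suc-double (suc m) (suc n) eq = double≢suc-double m n (suc-injective (suc-injective eq))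

nth-odd : ℕ → ℕ
nth-odd k = suc (double k)

even-or-odd : ∀ n → (∃ λ k → n ≡ double k) ⊎ (∃ λ k → n ≡ suc (double k))
even-or-odd zero          = inj₁ (0 , refl)
even-or-odd (suc zero)    = inj₂ (0 , refl)
even-or-odd (suc (suc n)) with even-or-odd n
... | inj₁ (k , refl) = inj₁ (suc k , refl)
... | inj₂ (k , refl) = inj₂ (suc k , refl)

-- γ₁ > γ₂ > … for the entries of the pairs, all of them below m; only the very last may be 0.
data Decreasing : ℕ → Rows → Set where
  []   : Decreasing m []
  cons : x < m → y < x → Decreasing y ps → Decreasing m ((x , y) ∷ ps)

Decreasing-mono : ∀ {n} → m ≤ n → Decreasing m ps → Decreasing n ps
Decreasing-mono m≤n []               = []
Decreasing-mono m≤n (cons x<m y<x D) = cons (≤-trans x<m m≤n) y<x D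

-- The pairs of Bressoud's image, off which no insertion can be read. `odd b` is the pair of
-- `wide (suc b)`; the pair (1 , 0) falls under `close`.
data Tight : ℕ × ℕ → Set where
  close : Tight (suc y , y)
  odd   : ∀ b → y ≡ suc (double b) → Tight (suc (suc y) , y)

data Admissible (d : ℕ) : ℕ × ℕ → Set where
  tight : Tight p → Admissible d p
  even  : ∀ e → y ≡ double e → d ≤ e → Admissible d (suc (suc y) , y)
  gap   : d ≡ 0 → 3 + y ≤ x → Admissible d (x , y)

-- All the values a readable off the pairs satisfy a > d, if the head is at place 0.  Numbering the
-- tail from 0 as well lowers a and d by 1; for d = 0 the condition is void, so pred may truncate.
data Insertable : ℕ → Rows → Set where
  []  : Insertable d []
  _∷_ : Admissible d p → Insertable (pred d) ps → Insertable d (p ∷ ps)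

-- I_{d + 1} on pairs.  The equation in new, instead of an index double d, lets two insertions with
-- the same result be matched against each other.
data Ins : ℕ → Rows → Rows → Set where
  new   : y ≡ double d → Decreasing y ps → Ins d ps ((suc (suc y) , y) ∷ ps)
  widen : y < x → Ins 0 ((x , y) ∷ ps) ((suc (suc x) , y) ∷ ps)
  pass  : double (suc d) ≤ x → Ins d ps qs →
          Ins (suc d) ((x , y) ∷ ps) ((suc (suc x) , suc (suc y)) ∷ qs)

Admissible-mono : d ≤ e → Admissible e p → Admissible d p
Admissible-mono d≤e (tight t)       = tight t
Admissible-mono d≤e (even k eq e≤k) = even k eq (≤-trans d≤e e≤k)
Admissible-mono z≤n (gap refl g)    = gap refl g

Insertable-mono : d ≤ e → Insertable e ps → Insertable d ps
Insertable-mono d≤e []      = []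
Insertable-mono d≤e (a ∷ i) = Admissible-mono d≤e a ∷ Insertable-mono (pred-mono-≤ d≤e) i

Tight⇒Insertable : All Tight ps → Insertable d ps
Tight⇒Insertable []       = []
Tight⇒Insertable (t ∷ ts) = tight t ∷ Tight⇒Insertable ts

Tight-+2 : Tight (x , y) → Tight (2 + x , 2 + y)
Tight-+2 close      = close
Tight-+2 (odd b eq) = odd (suc b) (cong (λ k → 2+ k) eq)

Admissible-+2 : Admissible d (x , y) → Admissible d (2 + x , 2 + y)
Admissible-+2 (tight t)       = tight (Tight-+2 t)
Admissible-+2 (even e eq d≤e) = even (suc e) (cong (λ k → 2+ k) eq) (m≤n⇒m≤1+n d≤e)
Admissible-+2 (gap d≡0 g)     = gap d≡0 (s≤s (s≤s g))

-- Sorted by the difference: 1 is `close`, 2 is decided by the parity of `y`, anything larger is a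
-- gap.
classify : y < x → Admissible 0 (x , y)
classify {y} y<x with m≤n⇒∃[o]m+o≡n y<x
... | zero , refl rewrite +-identityʳ y = tight close
... | suc zero , refl rewrite +-suc y 0 | +-identityʳ y with even-or-odd y
...   | inj₁ (k , eq) = even k eq z≤n
...   | inj₂ (k , eq) = tight (odd k eq)
classify {y} y<x | suc (suc k) , refl rewrite +-suc y (suc k) | +-suc y k =
  gap refl (s≤s (s≤s (s≤s (m≤m+n y k))))

insert-exists : ∀ d → Decreasing m ps → ∃ (Ins d ps)
insert-exists d       []             = _ , new refl []
insert-exists zero    (cons _ y<x D) = _ , widen y<x
insert-exists (suc d) (cons {x = x} _ y<x D) with x <? double (suc d)
... | yes x<2d = _ , new refl (cons x<2d y<x D)
... | no  x≮2d with qs , i ← insert-exists d D = _ , pass (≮⇒≥ x≮2d) i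

-- What keeps the parts distinct when an insertion passes (x , y): the lower entry leaves room for
-- whatever is inserted behind it. A gap is excluded by `suc d`; for `odd`, the parity of `y`
-- supplies the missing unit.
admissible-lower : Admissible (suc d) (x , y) → double (suc d) ≤ x → double d < y
admissible-lower (tight close)         (s≤s le) = le
admissible-lower (tight (odd b refl))  le = s≤s (double-mono (double-cancel (≤-pred (≤-pred le))))
admissible-lower (even e refl d<e)     le = ≤-trans (n≤1+n _) (double-mono d<e)

Ins-decreasing : Ins d ps qs → Insertable d ps → Decreasing m ps → double d < m →
                 Decreasing (2 + m) qs
Ins-decreasing (new refl D)  _       _                2d<m = cons (s≤s (s≤s 2d<m)) (n≤1+n _) D
Ins-decreasing (widen _)     _       (cons x<m y<x D) _    =
  cons (s≤s (s≤s x<m)) (m≤n⇒m≤1+n (m≤n⇒m≤1+n y<x)) D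
Ins-decreasing (pass 2d≤x i) (a ∷ g) (cons x<m y<x D) _    =
  cons (s≤s (s≤s x<m)) (s≤s (s≤s y<x)) (Ins-decreasing i g D (admissible-lower a 2d≤x))

-- The inserted pair is readable exactly at the bound: `even` with e = d, or a gap at d = 0. Passed
-- pairs keep their kind when both entries rise by 2, and pairs behind a `new` one move one place
-- on, where the bound is weaker.
Ins-insertable : Ins d ps qs → Insertable d ps → Insertable d qs
Ins-insertable (new eq _)   g       = even _ eq ≤-refl ∷ Insertable-mono pred[n]≤n g
Ins-insertable (widen y<x)  (_ ∷ g) = gap refl (s≤s (s≤s y<x)) ∷ g
Ins-insertable (pass _ i)   (a ∷ g) = Admissible-+2 a ∷ Ins-insertable i g

Insertable-0 : Decreasing m ps → Insertable 0 ps
Insertable-0 []             = []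
Insertable-0 (cons _ y<x D) = classify y<x ∷ Insertable-0 D

Tight-parity : ∀ d → Tight (x , y) → x ≡ suc (suc y) → y ≢ double d
Tight-parity d close eq _ = contradiction (suc-injective eq) (<⇒≢ ≤-refl)
Tight-parity d (odd b eq) _ eq′ = double≢suc-double d b (trans (sym eq′) eq)

Tight-narrow : Tight (x , y) → x ≤ 2 + y
Tight-narrow close     = n≤1+n _
Tight-narrow (odd _ _) = ≤-refl

Admissible-narrow : Admissible (suc d) (x , y) → x ≤ 2 + y
Admissible-narrow (tight t)    = Tight-narrow t
Admissible-narrow (even _ _ _) = ≤-refl

Ins-not-tight : Ins d ps qs → ¬ All Tight qs
Ins-not-tight (new eq _)  (t ∷ _)  = Tight-parity _ t refl eq
Ins-not-tight (widen y<x) (t ∷ _)  = <⇒≱ y<x (≤-pred (≤-pred (Tight-narrow t)))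
Ins-not-tight (pass _ i)  (_ ∷ ts) = Ins-not-tight i ts

-- An even pair with d ≤ e would have upper entry above 2d, and a gap would need d = 0, where
-- nothing fits below the bound. Each pair uses up at least 2 of the bound, in step with `pred d`.
Insertable⇒Tight : Insertable d ps → Decreasing (double d) ps → All Tight ps
Insertable⇒Tight []      []             = []
Insertable⇒Tight {zero}  (a ∷ g) (cons () _ _)
Insertable⇒Tight {suc d} (a ∷ g) (cons x<2d y<x D) with a
... | tight t       = t ∷ Insertable⇒Tight g (Decreasing-mono (≤-pred (≤-trans y<x (≤-pred x<2d))) D)
... | even e refl d<e = contradiction (≤-trans x<2d (double-mono d<e)) (<⇒≱ (m≤n⇒m≤1+n (n≤1+n _)))

-- The head of `qs` reveals which rule was used. Behind a `new` pair everything is tight, whereas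
-- behind a passed pair an insertion is visible; a widened pair has difference at least 3, whereas a
-- passed one has at most 2.
Ins-injective : ∀ {d d′ ps ps′ qs} → Ins d ps qs → Ins d′ ps′ qs →
                Insertable d ps → Insertable d′ ps′ → d ≡ d′ × ps ≡ ps′
Ins-injective (new eq _)  (new eq′ _)  _ _ = double-injective (trans (sym eq) eq′) , refl
Ins-injective (new eq D)  (widen y<x)  _ _ = contradiction y<x (<-irrefl refl)
Ins-injective (new eq D)  (pass _ i)   g _ =
  ⊥-elim (Ins-not-tight i (Insertable⇒Tight g (subst (λ k → Decreasing k _) eq D)))
Ins-injective (widen y<x) (new eq D)   _ _ = contradiction y<x (<-irrefl refl)
Ins-injective (pass _ i)  (new eq D)   _ g =
  ⊥-elim (Ins-not-tight i (Insertable⇒Tight g (subst (λ k → Decreasing k _) eq D)))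
Ins-injective (widen _)   (widen _)    _ _ = refl , refl
Ins-injective (widen y<x) (pass _ _)   _ (a ∷ _) = contradiction (Admissible-narrow a) (<⇒≱ y<x)
Ins-injective (pass _ _)  (widen y<x)  (a ∷ _) _ = contradiction (Admissible-narrow a) (<⇒≱ y<x)
Ins-injective (pass _ i)  (pass _ j)   (_ ∷ g) (_ ∷ h) with Ins-injective i j g h
... | refl , refl = refl , refl

Ins-head : Ins d ps qs → Decreasing m qs → double (suc d) < m
Ins-head (new refl _) (cons x<m _ _) = x<m
Ins-head (widen y<x)  (cons x<m _ _) = ≤-trans (s≤s (s≤s (s≤s z≤n))) x<m
Ins-head (pass le _)  (cons x<m _ _) = ≤-trans (s≤s (s≤s (s≤s le))) x<m

Tight-∸2 : Tight (suc (suc x) , suc (suc y)) → 0 < y → Tight (x , y)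
Tight-∸2 close             _ = close
Tight-∸2 (odd (suc b) eq)  _ = odd b (suc-injective (suc-injective eq))

Admissible-∸2 : Admissible 0 (suc (suc x) , suc (suc y)) → x ≤ 2 + y → double d < y →
                Admissible (suc d) (x , y)
Admissible-∸2 (tight t)           _  2d<y = tight (Tight-∸2 t (≤-trans (s≤s z≤n) 2d<y))
Admissible-∸2 (even (suc e) refl _) _ 2d<y = even e refl (double-cancel (s≤s 2d<y))
Admissible-∸2 (gap _ g)           le _    = contradiction (≤-pred (≤-pred g)) (<⇒≱ (s≤s le))

-- An insertion found in the tail takes precedence over an even head: by `Ins-head` its value is the
-- smaller one, and the same inequality allows both entries of the head to be lowered by 2.
narrow-head : Admissible 0 (x , y) → x ≤ 2 + y → x < m → y < x → Decreasing y qs →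
  (All Tight qs ⊎ ∃₂ λ d ps → Ins d ps qs × Insertable d ps × Decreasing (y ∸ 2) ps) →
  All Tight ((x , y) ∷ qs) ⊎
    ∃₂ λ d ps → Ins d ps ((x , y) ∷ qs) × Insertable d ps × Decreasing (m ∸ 2) ps
narrow-head a le x<m y<x D (inj₂ (d , ps , i , g , D′)) with Ins-head i D
narrow-head {m = suc (suc m)} a le (s≤s (s≤s x<m)) (s≤s (s≤s y<x)) D (inj₂ (d , ps , i , g , D′))
  | s≤s (s≤s 2d<y) =
  inj₂ (suc d , _ , pass (≤-trans (s≤s 2d<y) y<x) i ,
        Admissible-∸2 a (≤-pred (≤-pred le)) 2d<y ∷ g , cons x<m y<x D′)
narrow-head (tight t) _ _ _ _ (inj₁ ts) = inj₁ (t ∷ ts)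
narrow-head (even e eq _) _ x<m _ D (inj₁ ts) =
  inj₂ (e , _ , new eq D , Tight⇒Insertable ts , Decreasing-mono (∸-monoˡ-≤ 2 (<⇒≤ x<m)) D)
narrow-head (gap _ g) le _ _ _ (inj₁ _) = contradiction g (<⇒≱ (s≤s le))

-- Undoes the insertion with the least readable value. A gap at the head has the least value
-- possible, so it is undone at once. The bound falls to `m ∸ 2` so that the result fits below a
-- pair in front that is lowered as well.
tight-or-inserted : Decreasing m qs →
  All Tight qs ⊎ ∃₂ λ d ps → Ins d ps qs × Insertable d ps × Decreasing (m ∸ 2) ps
tight-or-inserted [] = inj₁ []
tight-or-inserted (cons x<m y<x D) with classify y<x
tight-or-inserted {suc (suc m)} (cons (s≤s (s≤s x<m)) y<x D) | gap _ (s≤s (s≤s y<x′)) =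
  inj₂ (0 , _ , widen y<x′ , classify y<x′ ∷ Insertable-0 D , cons x<m y<x′ D)
... | a@(tight t)       = narrow-head a (Tight-narrow t) x<m y<x D (tight-or-inserted D)
... | a@(even _ _ _)    = narrow-head a ≤-refl x<m y<x D (tight-or-inserted D)

-- From lists of pairs to lists of parts

double≡2* : ∀ n → double n ≡ 2 * n
double≡2* zero    = refl
double≡2* (suc n) = trans (cong (λ k → 2+ k) (double≡2* n)) (sym (*-suc 2 n))

double≡+ : ∀ n → double n ≡ n + n
double≡+ zero    = refl
double≡+ (suc n) = cong suc (trans (cong suc (double≡+ n)) (sym (+-suc n n)))

Odd-suc-double : ∀ k → Odd (suc (double k))
Odd-suc-double zero    = refl
Odd-suc-double (suc k) = Odd-suc-double k

¬Odd-double : ∀ k → ¬ Odd (double k)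
¬Odd-double (suc k) = ¬Odd-double k

raw : Rows → List ℕ
raw = concatMap (λ (x , y) → x ∷ y ∷ [])

flat : Rows → List ℕ
flat ps = filter (0 <?_) (raw ps)

part-0-flat : Decreasing m ps → 0 < m → part 0 (flat ps) < m
part-0-flat []                          0<m = 0<m
part-0-flat (cons {x = suc x} x<m _ _)  _   = x<m

insertAt-flat : Ins d ps qs → Decreasing m ps → insertAt d (flat ps) ≡ flat qs
insertAt-flat {d = zero} (new refl []) _ = refl
insertAt-flat {d = suc d} (new {ps = ps} refl D) _
  rewrite dec-true (part 0 (flat ps) <? 2 * suc d)
            (subst (part 0 (flat ps) <_) (double≡2* (suc d)) (part-0-flat D (s≤s z≤n)))
  = cong₂ (λ k l → k ∷ l ∷ flat ps) (trans (+-comm _ 2) (cong (λ k → 2+ k) (sym eq))) (sym eq)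
  where
  eq = double≡2* (suc d)
insertAt-flat (widen {y = zero} {x = suc x} _) (cons _ _ []) = cong (λ k → suc k ∷ []) (+-comm x 2)
insertAt-flat (widen {y = suc y} {x = suc x} {ps = ps} _) _ =
  cong (λ k → suc k ∷ suc y ∷ flat ps) (+-comm x 2)
insertAt-flat (pass {d = d} {x = suc x} {ps = ps} {qs = qs} {y = y} le i) (cons _ y<x D)
  rewrite dec-false (suc x <? 2 * suc d) (≤⇒≯ (subst (_≤ suc x) (double≡2* (suc d)) le))
        | +-comm x 2 = cong (3 + x ∷_) (lower y D)
  where
  -- For y = 0 the entry has been filtered out and `ps` is empty; the convention in `part` supplies
  -- the zero that becomes 2.
  lower : ∀ y → Decreasing y ps →
          part 1 (flat ((suc x , y) ∷ ps)) + 2 ∷ insertAt d (drop 2 (flat ((suc x , y) ∷ ps)))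
            ≡ 2 + y ∷ flat qs
  lower zero    [] = cong (2 ∷_) (insertAt-flat i D)
  lower (suc y) D  = cong₂ (λ k r → suc k ∷ r) (+-comm y 2) (insertAt-flat i D)

raw-antitone : Decreasing m ps → AllPairs _>_ (raw ps) × All (_< m) (raw ps)
raw-antitone []                 = [] , []
raw-antitone (cons x<m y<x D) with raw-antitone D
... | ap , below =
  ((y<x ∷ All.map (λ z<y → <-trans z<y y<x) below) ∷ below ∷ ap) ,
  x<m ∷ <-trans y<x x<m ∷ All.map (λ z<y → <-trans z<y (<-trans y<x x<m)) below

flat-antitone : Decreasing m ps → AllPairs _>_ (flat ps)
flat-antitone D = AllPairs.filter⁺ (0 <?_) (proj₁ (raw-antitone D))

flat-positive : ∀ ps → All (0 <_) (flat ps)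
flat-positive ps = All.all-filter (0 <?_) (raw ps)

unflatten : ∀ {γ} → AllPairs _>_ γ → All (0 <_) γ → All (_< m) γ →
            ∃ λ ps → Decreasing m ps × flat ps ≡ γ
unflatten [] _ _ = [] , [] , refl
unflatten {γ = suc x ∷ []} _ _ (x<m ∷ _) = (suc x , 0) ∷ [] , cons x<m (s≤s z≤n) [] , refl
unflatten {γ = suc x ∷ suc y ∷ γ} ((y<x ∷ _) ∷ y>γ ∷ >γ) (_ ∷ _ ∷ pos) (x<m ∷ _)
  with unflatten >γ pos y>γ
... | ps , D , eq = _ ∷ ps , cons x<m y<x D , cong (λ r → suc x ∷ suc y ∷ r) eq
unflatten {γ = zero ∷ γ} _ (() ∷ _) _
unflatten {γ = suc x ∷ zero ∷ γ} _ (_ ∷ () ∷ _) _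

flat-injective : ∀ {m n} → Decreasing m ps → Decreasing n qs → flat ps ≡ flat qs → ps ≡ qs
flat-injective [] [] _ = refl
flat-injective [] (cons {x = suc _} _ _ _) ()
flat-injective (cons {x = suc _} _ _ _) [] ()
flat-injective (cons {x = suc x} {y = zero} _ _ [])  (cons {x = suc x′} {y = zero} _ _ []) eq
  with refl ← eq = refl
flat-injective (cons {x = suc x} {y = zero} _ _ [])  (cons {x = suc x′} {y = suc _} _ _ _) ()
flat-injective (cons {x = suc x} {y = suc y} _ _ _)  (cons {x = suc x′} {y = zero} _ _ []) ()
flat-injective (cons {x = suc x} {y = suc y} _ _ D)  (cons {x = suc x′} {y = suc y′} _ _ E) eq
  with refl ← ∷-injectiveˡ eq | refl ← ∷-injectiveˡ (∷-injectiveʳ eq) =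
  cong (_ ∷_) (flat-injective D E (∷-injectiveʳ (∷-injectiveʳ eq)))

-- Sum, alternating sum and odd parts under insertion

sum-positive : ∀ xs → sum (filter (0 <?_) xs) ≡ sum xs
sum-positive []           = refl
sum-positive (zero ∷ xs)  = sum-positive xs
sum-positive (suc x ∷ xs) = cong (λ k → suc x + k) (sum-positive xs)

ℓₒ-positive : ∀ xs → ℓₒ (filter (0 <?_) xs) ≡ ℓₒ xs
ℓₒ-positive []           = refl
ℓₒ-positive (zero ∷ xs)  = ℓₒ-positive xs
ℓₒ-positive (suc x ∷ xs) with does (odd? (suc x))
... | true  = cong suc (ℓₒ-positive xs)
... | false = ℓₒ-positive xs

altSum-flat : Decreasing m ps → altSum (flat ps) ≡ altSum (raw ps)
altSum-flat [] = refl
altSum-flat (cons {x = suc x} {y = zero} _ _ []) = refl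
altSum-flat (cons {x = suc x} {y = suc y} _ _ D) =
  cong (λ k → + (suc x) ℤ.- (+ (suc y) ℤ.- k)) (altSum-flat D)

-- The amount is 2(2d + 1). Passing a pair adds 4, which is how much this amount drops when d drops
-- by 1.
Ins-sum : Ins d ps qs → sum (raw qs) ≡ double (suc (double d)) + sum (raw ps)
Ins-sum (new {d = d} {ps = ps} refl _) =
  trans (cong (λ k → 2+ k) (sym (+-assoc (double d) (double d) _)))
    (cong (λ k → 2+ (k + sum (raw ps))) (sym (double≡+ (double d))))
Ins-sum (widen _) = refl
Ins-sum (pass {d = d} {x = x} {y = y} _ i) =
  trans (cong (λ k → 2 + x + (2 + y + k)) (Ins-sum i)) (lem x y (double (double d)) _)
  where
  lem : ∀ x y k s → 2 + x + (2 + y + (2 + k + s)) ≡ 6 + k + (x + (y + s))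
  lem = solve-∀

Ins-sum-< : Ins d ps qs → sum (raw ps) < sum (raw qs)
Ins-sum-< i = subst (_ <_) (sym (Ins-sum i)) (s≤s (m≤n⇒m≤1+n (m≤n+m _ _)))

Ins-altSum : Ins d ps qs → altSum (raw qs) ≡ + 2 ℤ.+ altSum (raw ps)
Ins-altSum (new {y} {ps = ps} _ _) = lem (+ y) (altSum (raw ps))
  where
  lem : ∀ y a → + 2 ℤ.+ y ℤ.- (y ℤ.- a) ≡ + 2 ℤ.+ a
  lem = ℤSolver.solve-∀
Ins-altSum (widen {y} {x} {ps} _) = lem (+ x) (+ y ℤ.- altSum (raw ps))
  where
  lem : ∀ x a → + 2 ℤ.+ x ℤ.- a ≡ + 2 ℤ.+ (x ℤ.- a)
  lem = ℤSolver.solve-∀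
Ins-altSum (pass {x = x} {ps = ps} {y = y} _ i) =
  trans (cong (λ k → + (2 + x) ℤ.- (+ (2 + y) ℤ.- k)) (Ins-altSum i)) (lem (+ x) (+ y) (altSum (raw ps)))
  where
  lem : ∀ x y a → (+ 2 ℤ.+ x) ℤ.- ((+ 2 ℤ.+ y) ℤ.- (+ 2 ℤ.+ a)) ≡ + 2 ℤ.+ (x ℤ.- (y ℤ.- a))
  lem = ℤSolver.solve-∀

ℓₒ-cong : ∀ x {xs ys} → ℓₒ xs ≡ ℓₒ ys → ℓₒ (x ∷ xs) ≡ ℓₒ (x ∷ ys)
ℓₒ-cong x eq with does (odd? x)
... | true  = cong suc eq
... | false = eq

ℓₒ-+2 : ∀ x xs → ℓₒ (2 + x ∷ xs) ≡ ℓₒ (x ∷ xs)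
ℓₒ-+2 x xs with does (odd? x)
... | true  = refl
... | false = refl

ℓₒ-double : ∀ d xs → ℓₒ (double d ∷ xs) ≡ ℓₒ xs
ℓₒ-double d xs rewrite dec-false (odd? (double d)) (¬Odd-double d) = refl

Ins-ℓₒ : Ins d ps qs → ℓₒ (raw qs) ≡ ℓₒ (raw ps)
Ins-ℓₒ (new {d = d} refl _) = trans (ℓₒ-double (suc d) _) (ℓₒ-double d _)
Ins-ℓₒ (widen {x = x} _) = ℓₒ-+2 x _
Ins-ℓₒ (pass {x = x} {y = y} _ i) = trans (ℓₒ-+2 x _) (ℓₒ-cong x (trans (ℓₒ-+2 y _) (ℓₒ-cong y (Ins-ℓₒ i))))

-- Bressoud's map

-- Every index is at most m − 2.
data Initial : ℕ → List Pair → Set where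
  []    : Initial m []
  close : 2 + a ≤ m → Initial a π → Initial m (close a ∷ π)
  wide  : 3 + b ≤ m → Initial (suc b) π → Initial m (wide (suc b) ∷ π)

-- As for Decreasing, m is a strict upper bound of the entries.
data Final : ℕ → List Pair → Set where
  []    : Final m []
  close : 2 + a ≤ m → Final a ρ → Final m (close a ∷ ρ)
  wide  : 4 + double b ≤ m → Final (suc (double b)) ρ → Final m (wide (suc b) ∷ ρ)

Stops : ℕ → List Pair → Set
Stops a (wide b ∷ ρ) = 2 + double b ≤ a
Stops a _            = ⊤

-- All interchanges of one `close a` with the settled list behind it. Under `Lead a ρ` the
-- subtraction is never truncated, since the `wide` case of `Lead` forces a ≥ 2.
data Slide : ℕ → List Pair → List Pair → Set where
  stop : Stops a ρ → Slide a ρ (close a ∷ ρ)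
  pass : a ≤ suc (double b) → Slide (a ∸ 2) ρ σ → Slide a (wide b ∷ ρ) (wide (suc b) ∷ σ)

data Settles : List Pair → List Pair → Set where
  []    : Settles [] []
  close : Settles π ρ → Slide a ρ σ → Settles (close a ∷ π) σ
  wide  : Settles π ρ → Settles (wide b ∷ π) (wide b ∷ ρ)

-- On settled lists, Lead a says that all indices were at most a − 2 before settling
-- (Settles-lead, Settles-lead⁻).
data Lead : ℕ → List Pair → Set where
  []    : Lead m []
  close : a ≤ m → Lead (2 + m) (close a ∷ ρ)
  wide  : b ≤ m → Lead m ρ → Lead (2 + m) (wide b ∷ ρ)

Initial-mono : m ≤ n → Initial m π → Initial n π
Initial-mono m≤n []          = []
Initial-mono m≤n (close p I) = close (≤-trans p m≤n) I
Initial-mono m≤n (wide p I)  = wide (≤-trans p m≤n) I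

Final-mono : m ≤ n → Final m π → Final n π
Final-mono m≤n []          = []
Final-mono m≤n (close p F) = close (≤-trans p m≤n) F
Final-mono m≤n (wide p F)  = wide (≤-trans p m≤n) F

n≤double : ∀ n → n ≤ double n
n≤double zero    = z≤n
n≤double (suc n) = s≤s (m≤n⇒m≤1+n (n≤double n))

Slide-deterministic : ∀ {σ σ′} → Slide a ρ σ → Slide a ρ σ′ → σ ≡ σ′
Slide-deterministic (stop _)     (stop _)      = refl
Slide-deterministic (stop s)     (pass a≤ _)   = contradiction a≤ (<⇒≱ s)
Slide-deterministic (pass a≤ _)  (stop s)      = contradiction a≤ (<⇒≱ s)
Slide-deterministic (pass _ s)   (pass _ t)    = cong (_ ∷_) (Slide-deterministic s t)

Settles-deterministic : ∀ {ρ ρ′} → Settles π ρ → Settles π ρ′ → ρ ≡ ρ′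
Settles-deterministic []          []          = refl
Settles-deterministic (close S s) (close T t) with refl ← Settles-deterministic S T = Slide-deterministic s t
Settles-deterministic (wide S)    (wide T)    = cong (_ ∷_) (Settles-deterministic S T)

-- The pair that slid is the first `close` of σ, so σ tells how far it went; `Lead` writes a as 2 +
-- m at each pass, which makes `a ∸ 2` determine a.
Slide-injective : ∀ {a a′ ρ ρ′} → Slide a ρ σ → Slide a′ ρ′ σ → Lead a ρ → Lead a′ ρ′ →
                  a ≡ a′ × ρ ≡ ρ′
Slide-injective (stop _)   (stop _)   _ _ = refl , refl
Slide-injective (pass _ s) (pass _ t) (wide _ l) (wide _ l′) with Slide-injective s t l l′
... | refl , refl = refl , refl

Slide-lead : ∀ {a′} → Slide a′ ρ σ → Lead a′ ρ → a′ ≤ a → Lead (2 + a) σ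
Slide-lead (stop _)   _            le              = close le
Slide-lead (pass _ s) (wide b≤k l) (s≤s (s≤s k≤a)) =
  wide (s≤s (≤-trans b≤k (m≤n⇒m≤1+n k≤a))) (Slide-lead s l k≤a)

Slide-lead⁻ : ∀ {a′} → Slide a′ ρ σ → Lead a′ ρ → Lead a σ → 2 + a′ ≤ a
Slide-lead⁻ (stop _)   _          (close le)  = s≤s (s≤s le)
Slide-lead⁻ (pass _ s) (wide _ l) (wide _ l′) = s≤s (s≤s (Slide-lead⁻ s l l′))

Settles-lead : Initial a π → Settles π ρ → Lead a ρ
Settles-lead []                        []          = []
Settles-lead (close (s≤s (s≤s le)) I) (close S s) = Slide-lead s (Settles-lead I S) le
Settles-lead (wide (s≤s (s≤s le)) I)  (wide S)    = wide le (Settles-lead (Initial-mono le I) S)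

Settles-lead⁻ : Initial n π → Settles π ρ → Lead a ρ → Initial a π
Settles-lead⁻ []          []          _             = []
Settles-lead⁻ (close _ I) (close S s) l             = close (Slide-lead⁻ s (Settles-lead I S) l) I
Settles-lead⁻ (wide _ I)  (wide S)    (wide b≤m l) = wide (s≤s (s≤s b≤m)) I

mutual
  -- If π starts with a close pair, injectivity identifies the given slide with the one that settled
  -- it, and the bound is that of `Initial`. The other shape is impossible by `wide-blocked`.
  Settles-slide : Initial m π → Settles π ρ → Slide a σ ρ → Lead a σ → 2 + a ≤ m
  Settles-slide (close le I) (close S s) t l
    with refl , refl ← Slide-injective s t (Settles-lead I S) l = le
  Settles-slide (wide le I)  (wide S)    t l = ⊥-elim (wide-blocked I S t l)

  -- This tells the two shapes of first pair apart. Sliding back over `wide (suc b)` requires an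
  -- index k ≥ b just behind it, but the pairs behind had indices at most b - 1 before settling.
  wide-blocked : Initial (suc b) π → Settles π ρ → Slide a σ (wide (suc b) ∷ ρ) → ¬ Lead a σ
  wide-blocked I S (pass _ t) (wide b≤k l) = <⇒≱ (≤-pred (Settles-slide I S t l)) b≤k

Settles-injective : ∀ {π π′} → Initial m π → Initial n π′ → Settles π ρ → Settles π′ ρ → π ≡ π′
Settles-injective []          []          []          []          = refl
Settles-injective []          (close _ _) []          (close _ ())
Settles-injective (close _ _) []          (close _ ()) []
Settles-injective (close _ I) (close _ J) (close S s) (close T t)
  with refl , refl ← Slide-injective s t (Settles-lead I S) (Settles-lead J T) =
  cong (_ ∷_) (Settles-injective I J S T)
Settles-injective (close _ I) (wide _ J)  (close S s) (wide T)    = ⊥-elim (wide-blocked J T s (Settles-lead I S))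
Settles-injective (wide _ I)  (close _ J) (wide S)    (close T t) = ⊥-elim (wide-blocked I S t (Settles-lead J T))
Settles-injective (wide _ I)  (wide _ J)  (wide S)    (wide T)    = cong (_ ∷_) (Settles-injective I J S T)

Final-lead : Final a ρ → Lead a ρ
Final-lead []                                 = []
Final-lead (close (s≤s (s≤s le)) F)           = close le
Final-lead (wide {b = b} (s≤s (s≤s le)) F)    =
  wide (≤-trans (s≤s (n≤double b)) (≤-trans (n≤1+n _) le))
    (Final-lead (Final-mono (≤-trans (n≤1+n _) le) F))

Final-stops : Final a ρ → Stops a ρ
Final-stops []          = tt
Final-stops (close _ _) = tt
Final-stops (wide le _) = le

stops-final : Final m ρ → Stops a ρ → Lead a ρ → Final a ρ
stops-final []          _ _          = []
stops-final (close _ F) _ (close le) = close (s≤s (s≤s le)) F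
stops-final (wide _ F)  s _          = wide s F

Slide-final : Final m ρ → Slide a ρ σ → Lead a ρ → a ≤ m → Final (2 + m) σ
Slide-final F           (stop s)    l          le = close (s≤s (s≤s le)) (stops-final F s l)
Slide-final (wide p F)  (pass (s≤s (s≤s q)) s) (wide _ l) le = wide (s≤s (s≤s p)) (Slide-final F s l q)

-- The bound 2m - 1 is what the induction needs: behind `wide (suc b)` one has m = b + 1, which
-- gives 2b + 1, the lower entry of that pair.
Settles-final : Initial m π → Settles π ρ → Final (pred (double m)) ρ
Settles-final []           []          = []
Settles-final (close {a = a} le I) (close S s) =
  Final-mono (≤-trans (n≤1+n _) (pred-mono-≤ (double-mono le)))
    (Slide-final (Final-mono pred[n]≤n (Settles-final I S)) s (Settles-lead I S) (n≤double a))
Settles-final (wide le I)  (wide S)    =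
  wide (≤-trans (n≤1+n _) (pred-mono-≤ (double-mono le))) (Settles-final I S)

Slide-bound : Final m ρ → Slide a σ ρ → Lead a σ → 2 + a ≤ m
Slide-bound (close le _) (stop _)   _          = le
Slide-bound (wide le F)  (pass _ s) (wide _ l) = ≤-trans (s≤s (s≤s (m≤n⇒m≤1+n (Slide-bound F s l)))) le

-- Decides whether the first `close` can slide back to the front. `Slide-bound` makes the
-- interchange condition automatic, so at each wide pair only the test b ≤ a of `Lead` remains.
pull : Final m ρ →
  (∃₂ λ a σ → Slide a σ ρ × Lead a σ × Final (m ∸ 2) σ) ⊎ (∀ {a σ} → Slide a σ ρ → ¬ Lead a σ)
pull [] = inj₂ λ ()
pull (close le F) = inj₁ (_ , _ , stop (Final-stops F) , Final-lead F , Final-mono (∸-monoˡ-≤ 2 le) F)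
pull (wide {b = b} le F) with pull F
... | inj₂ none = inj₂ λ { (pass _ s) (wide _ l) → none s l }
... | inj₁ (a , σ , s , l , G) with b ≤? a | Slide-bound F s l
pull (wide {b = suc b} le F) | inj₁ (a , σ , s , l , G) | yes b≤a | s≤s bound =
  inj₁ (_ , _ , pass (s≤s bound) s , wide b≤a l , wide (∸-monoˡ-≤ 2 le) G)
pull (wide {b = zero} le F) | inj₁ (a , σ , s , l , G) | yes b≤a | s≤s ()
-- Any other slide into the tail has the same index, by injectivity, so it fails the same test.
... | no b≰a | _ = inj₂ λ { (pass _ t) (wide b≤k l′) →
  b≰a (subst (b ≤_) (proj₁ (Slide-injective t s l′ l)) b≤k) }

Slide-length : Slide a ρ σ → length σ ≡ suc (length ρ)
Slide-length (stop _)   = refl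
Slide-length (pass _ s) = cong suc (Slide-length s)

-- Were the first pair of π a close one with too large an index, that index would be large enough
-- for sliding it back over the wide pair. A wide first pair is bounded by `Final` directly.
pull-none : Initial n π → Settles π ρ → Final (suc (double b)) ρ →
  (∀ {a σ} → Slide a σ (wide (suc b) ∷ ρ) → ¬ Lead a σ) → Initial (suc b) π
pull-none [] [] _ _ = []
pull-none {b = b} (close {a = a} _ I) (close S s) F none with 2 + a ≤? suc b
... | yes le = close le I
... | no  ≰  = ⊥-elim (none (pass (Slide-bound F s l) s) (wide (≤-pred (≤-pred (≰⇒> ≰))) l))
  where l = Settles-lead I S
pull-none (wide _ I) (wide S) (wide le _) _ = wide (s≤s (double-cancel le)) I

-- Recursion on the length, because `pull` returns a rebuilt list. The first pair is made close
-- whenever a pull succeeds, and left wide otherwise.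
unsettle : ∀ k → length ρ ≡ k → Final m ρ → ∃₂ λ n π → Initial n π × Settles π ρ
unsettle _       _   [] = 0 , [] , [] , []
unsettle (suc k) len (close _ F)
  with n , π , I , S ← unsettle k (suc-injective len) F =
  _ , _ , close ≤-refl (Settles-lead⁻ I S (Final-lead F)) , close S (stop (Final-stops F))
unsettle (suc k) len (wide {b = b} le F) with pull (wide le F)
... | inj₁ (a , σ , s , l , G)
  with n , π , I , S ← unsettle k (suc-injective (trans (sym (Slide-length s)) len)) G =
  _ , _ , close ≤-refl (Settles-lead⁻ I S l) , close S s
... | inj₂ none
  with n , π , I , S ← unsettle k (suc-injective len) F =
  _ , _ , wide ≤-refl (pull-none I S F none) , wide S

-- Interchanges and slides

interchange-≤ : ∀ a b → (a ≤ᵇ 2 * b + 1) ≡ true → a ≤ suc (double b)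
interchange-≤ a b eq =
  subst (a ≤_) (trans (+-comm (2 * b) 1) (cong suc (sym (double≡2* b)))) (≤ᵇ⇒≤ a _ (subst T (sym eq) tt))

interchange-> : ∀ a b → (a ≤ᵇ 2 * b + 1) ≡ false → suc (double b) < a
interchange-> a b eq = ≰⇒> λ a≤ → subst T eq
  (≤⇒≤ᵇ (subst (a ≤_) (sym (trans (+-comm (2 * b) 1) (cong suc (sym (double≡2* b))))) a≤))

step-tail : ∀ p π → step (p ∷ π) ≡ nothing → step π ≡ nothing
step-tail _        []       _  = refl
step-tail (wide b) (q ∷ π) eq with step (q ∷ π)
... | nothing = refl
step-tail (close a) (close a′ ∷ π) eq with step (close a′ ∷ π)
... | nothing = refl
step-tail (close a) (wide b ∷ π) eq with a ≤ᵇ 2 * b + 1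
... | false with step (wide b ∷ π)
...   | nothing = refl

step-stops : ∀ a π → step (close a ∷ π) ≡ nothing → Stops a π
step-stops a []            _  = tt
step-stops a (close _ ∷ _) _  = tt
step-stops a (wide b ∷ _) eq with a ≤ᵇ 2 * b + 1 in le
... | false = interchange-> a b le

step-stable : ∀ π → step π ≡ nothing → Settles π π
step-stable []            _  = []
step-stable (close a ∷ π) eq =
  close (step-stable π (step-tail (close a) π eq)) (stop (step-stops a π eq))
step-stable (wide b ∷ π)  eq = wide (step-stable π (step-tail (wide b) π eq))

-- Undoing an interchange anywhere keeps the settled list: the order of interchanges is immaterial.
step-settles : ∀ π {π′} → step π ≡ just π′ → Settles π′ ρ → Settles π ρ
step-settles (wide b ∷ p ∷ π) eq S with step (p ∷ π) in eq′
step-settles (wide b ∷ p ∷ π) refl (wide S) | just _ = wide (step-settles (p ∷ π) eq′ S)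
step-settles (close a ∷ close a′ ∷ π) eq S with step (close a′ ∷ π) in eq′
step-settles (close a ∷ close a′ ∷ π) refl (close S s) | just _ =
  close (step-settles (close a′ ∷ π) eq′ S) s
step-settles (close a ∷ wide b ∷ π) eq S with a ≤ᵇ 2 * b + 1 in le
step-settles (close a ∷ wide b ∷ π) refl S | true rewrite +-comm b 1 with S
... | wide (close S′ s) = close (wide S′) (pass (interchange-≤ a b le) s)
step-settles (close a ∷ wide b ∷ π) eq S | false with step (wide b ∷ π) in eq′
step-settles (close a ∷ wide b ∷ π) refl (close S s) | false | just _ =
  close (step-settles (wide b ∷ π) eq′ S) s

stepUpTo-settles : ∀ k π → Settles (stepUpTo k π) ρ → Settles π ρ
stepUpTo-settles zero    π S = S
stepUpTo-settles (suc k) π S with step π in eq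
... | just π′ = step-settles π eq (stepUpTo-settles k π′ S)
... | nothing = S

-- The normal form settles to itself, as no interchange is left in it; this is carried back through
-- the interchanges one at a time.
normalise-settles : ∀ π → Settles π (normalise π)
normalise-settles π = stepUpTo-settles (inversions π) π (step-stable (normalise π) (normalise-normal π))

-- Settled lists as rows, and their statistics

row : Pair → ℕ × ℕ
row (close a) = suc a , a
row (wide b)  = suc (double b) , pred (double b)

rows : List Pair → Rows
rows = map row

entries-rows : ∀ π → concatMap entries π ≡ raw (rows π)
entries-rows []            = refl
entries-rows (close a ∷ π) = cong₂ (λ k r → k ∷ a ∷ r) (+-comm a 1) (entries-rows π)
entries-rows (wide b ∷ π)
  rewrite +-comm (2 * b) 1 | sym (double≡2* b) =
  cong (λ r → suc (double b) ∷ pred (double b) ∷ r) (entries-rows π)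

bressoud-rows : ∀ β → bressoud β ≡ flat (rows (normalise (initialPairs β)))
bressoud-rows β = cong (filter (0 <?_)) (entries-rows (normalise (initialPairs β)))

Final-decreasing : Final m ρ → Decreasing m (rows ρ)
Final-decreasing []          = []
Final-decreasing (close p F) = cons p ≤-refl (Final-decreasing F)
Final-decreasing (wide p F)  = cons p (n≤1+n _) (Final-decreasing F)

Final-tight : Final m ρ → All Tight (rows ρ)
Final-tight []          = []
Final-tight (close _ F) = close ∷ Final-tight F
Final-tight (wide _ F)  = odd _ refl ∷ Final-tight F

Tight-final : All Tight ps → Decreasing m ps → ∃ λ ρ → Final m ρ × rows ρ ≡ ps
Tight-final [] [] = [] , [] , refl
Tight-final (close ∷ ts) (cons {y = y} p _ D) with Tight-final ts D
... | ρ , F , eq = close y ∷ ρ , close p F , cong (_ ∷_) eq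
Tight-final (odd b refl ∷ ts) (cons p _ D) with Tight-final ts D
... | ρ , F , eq = wide (suc b) ∷ ρ , wide p F , cong (_ ∷_) eq

close≢wide : row (close a) ≢ row (wide (suc b))
close≢wide eq = <⇒≢ ≤-refl (trans (cong (suc ∘ proj₂) (sym eq)) (cong proj₁ eq))

rows-injective : ∀ {ρ ρ′} → Final m ρ → Final n ρ′ → rows ρ ≡ rows ρ′ → ρ ≡ ρ′
rows-injective []          []          _  = refl
rows-injective (close _ F) (close _ G) eq with ∷-injective eq
... | refl , eq′ = cong (_ ∷_) (rows-injective F G eq′)
rows-injective (close _ _) (wide _ _)  eq = ⊥-elim (close≢wide (∷-injectiveˡ eq))
rows-injective (wide _ _)  (close _ _) eq = ⊥-elim (close≢wide (sym (∷-injectiveˡ eq)))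
rows-injective (wide {b = b} _ F)  (wide {b = b′} _ G)  eq
  with refl ← double-injective {b} {b′} (suc-injective (cong proj₂ (∷-injectiveˡ eq))) =
  cong (_ ∷_) (rows-injective F G (∷-injectiveʳ eq))

-- The number of parts of β that make up the pair. For the pairs that occur it is also the
-- difference of the entries and the number of odd entries, so one count serves both statistics.
width : Pair → ℕ
width (close _) = 1
width (wide _)  = 2

widths : List Pair → ℕ
widths []      = 0
widths (p ∷ π) = width p + widths π

Slide-widths : Slide a ρ σ → widths σ ≡ suc (widths ρ)
Slide-widths (stop _)   = refl
Slide-widths (pass _ s) = cong (λ k → 2+ k) (Slide-widths s)

Settles-widths : Settles π ρ → widths ρ ≡ widths π
Settles-widths []          = refl
Settles-widths (close S s) = trans (Slide-widths s) (cong suc (Settles-widths S))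
Settles-widths (wide S)    = cong (λ k → 2+ k) (Settles-widths S)

Final-altSum : Final m ρ → altSum (raw (rows ρ)) ≡ + widths ρ
Final-altSum []                          = refl
Final-altSum (close {a = a} {ρ = ρ} _ F) =
  trans (cong (λ k → + suc a ℤ.- (+ a ℤ.- k)) (Final-altSum F)) (lem (+ a) (+ widths ρ))
  where
  lem : ∀ a w → (+ 1 ℤ.+ a) ℤ.- (a ℤ.- w) ≡ + 1 ℤ.+ w
  lem = ℤSolver.solve-∀
Final-altSum (wide {b = b} {ρ = ρ} _ F) =
  trans (cong (λ k → + (3 + double b) ℤ.- (+ suc (double b) ℤ.- k)) (Final-altSum F))
    (lem (+ suc (double b)) (+ widths ρ))
  where
  lem : ∀ b w → (+ 2 ℤ.+ b) ℤ.- (b ℤ.- w) ≡ + 2 ℤ.+ w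
  lem = ℤSolver.solve-∀

ℓₒ-suc-double : ∀ d xs → ℓₒ (suc (double d) ∷ xs) ≡ suc (ℓₒ xs)
ℓₒ-suc-double d xs rewrite dec-true (odd? (suc (double d))) (Odd-suc-double d) = refl

ℓₒ-consecutive : ∀ a xs → ℓₒ (suc a ∷ a ∷ xs) ≡ suc (ℓₒ xs)
ℓₒ-consecutive zero    xs = refl
ℓₒ-consecutive (suc a) xs =
  trans (ℓₒ-+2 a (suc a ∷ xs)) (trans (ℓₒ-swap a (suc a) xs) (ℓₒ-consecutive a xs))
  where
  ℓₒ-swap : ∀ x y xs → ℓₒ (x ∷ y ∷ xs) ≡ ℓₒ (y ∷ x ∷ xs)
  ℓₒ-swap x y xs with does (odd? x) in p | does (odd? y) in q
  ... | true  | true  rewrite p | q = refl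
  ... | true  | false rewrite p | q = refl
  ... | false | true  rewrite p | q = refl
  ... | false | false rewrite p | q = refl

Final-ℓₒ : Final m ρ → ℓₒ (raw (rows ρ)) ≡ widths ρ
Final-ℓₒ []                  = refl
Final-ℓₒ (close {a = a} _ F) = trans (ℓₒ-consecutive a _) (cong suc (Final-ℓₒ F))
Final-ℓₒ (wide {b = b} _ F)  =
  trans (ℓₒ-suc-double (suc b) _) (cong suc (trans (ℓₒ-suc-double b _) (cong suc (Final-ℓₒ F))))

-- Each interchange adds 4 to the wide pair and takes 4 from the close one; `Lead` guarantees that
-- there is enough to take.
Slide-sum : Final m ρ → Lead a ρ → Slide a ρ σ →
            sum (raw (rows σ)) ≡ suc a + (a + sum (raw (rows ρ)))
Slide-sum _                  _                  (stop _)   = refl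
Slide-sum (wide {b = b} _ F) (wide {m = k} _ l) (pass _ s) =
  trans (cong (λ r → 5 + double b + (3 + double b + r)) (Slide-sum F l s)) (lem (double b) k _)
  where
  lem : ∀ b k s → 5 + b + (3 + b + (suc k + (k + s))) ≡ 3 + k + (2 + k + (3 + b + (1 + b + s)))
  lem = solve-∀

Settles-sum : Initial m π → Settles π ρ → sum (raw (rows ρ)) ≡ sum (raw (rows π))
Settles-sum []          []          = refl
Settles-sum (close {a = a} _ I) (close S s) =
  trans (Slide-sum (Settles-final I S) (Settles-lead I S) s)
    (cong (λ r → suc a + (a + r)) (Settles-sum I S))
Settles-sum (wide {b = b} _ I) (wide S) =
  cong (λ r → 3 + double b + (suc (double b) + r)) (Settles-sum I S)

-- Runs of odd parts and lists of pairs

indices : List Pair → List ℕ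
indices []            = []
indices (close a ∷ π) = a ∷ indices π
indices (wide b ∷ π)  = b ∷ pred b ∷ indices π

⌊nth-odd/2⌋ : ∀ k → ⌊ nth-odd k /2⌋ ≡ k
⌊nth-odd/2⌋ zero    = refl
⌊nth-odd/2⌋ (suc k) = cong suc (⌊nth-odd/2⌋ k)

consRun-≢ : ∀ x y rs → x ≢ y + 2 → consRun x (consRun y rs) ≡ (x ∷ []) ∷ consRun y rs
consRun-≢ x y []             x≢ rewrite dec-false (x ≟ y + 2) x≢ = refl
consRun-≢ x y ([] ∷ rs)      x≢ rewrite dec-false (x ≟ y + 2) x≢ = refl
consRun-≢ x y ((z ∷ r) ∷ rs) x≢ with does (y ≟ z + 2)
... | true  rewrite dec-false (x ≟ y + 2) x≢ = refl
... | false rewrite dec-false (x ≟ y + 2) x≢ = refl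

-- Whether or not `y` joins the run starting with `z`, taking x and y off leaves the pairs of `rs`:
-- an exhausted run contributes nothing.
runPairs-consRun-≡ : ∀ x y rs → x ≡ y + 2 →
  concatMap runPairs (consRun x (consRun y rs)) ≡ wide ⌊ x /2⌋ ∷ concatMap runPairs rs
runPairs-consRun-≡ x y []             x≡ rewrite dec-true (x ≟ y + 2) x≡ = refl
runPairs-consRun-≡ x y ([] ∷ rs)      x≡ rewrite dec-true (x ≟ y + 2) x≡ = refl
runPairs-consRun-≡ x y ((z ∷ r) ∷ rs) x≡ with does (y ≟ z + 2)
... | true  rewrite dec-true (x ≟ y + 2) x≡ = refl
... | false rewrite dec-true (x ≟ y + 2) x≡ = refl

initialPairs-close : All (λ l → 2 + l ≤ a) ks →
  initialPairs (map nth-odd (a ∷ ks)) ≡ close a ∷ initialPairs (map nth-odd ks)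
initialPairs-close {a} []                  = cong (λ k → close k ∷ []) (⌊nth-odd/2⌋ a)
initialPairs-close {a} (_∷_ {x = l} {xs = ls} l<a _) =
  trans (cong (concatMap runPairs)
          (consRun-≢ (nth-odd a) (nth-odd l) (runs (map nth-odd ls)) a≢))
        (cong (λ k → close k ∷ initialPairs (map nth-odd (l ∷ ls))) (⌊nth-odd/2⌋ a))
  where
  a≢ : nth-odd a ≢ nth-odd l + 2
  a≢ eq = <⇒≢ l<a (sym (double-injective {a} {suc l} (suc-injective (trans eq (+-comm (nth-odd l) 2)))))

initialPairs-wide : ∀ b ks →
  initialPairs (map nth-odd (suc b ∷ b ∷ ks)) ≡ wide (suc b) ∷ initialPairs (map nth-odd ks)
initialPairs-wide b ks =
  trans (runPairs-consRun-≡ _ _ (runs (map nth-odd ks)) (+-comm 2 (nth-odd b)))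
        (cong (λ k → wide k ∷ initialPairs (map nth-odd ks)) (⌊nth-odd/2⌋ (suc b)))

far-below : ∀ {l} → l < a → a ≢ suc l → All (_< l) ks → All (λ k → 2 + k ≤ a) (l ∷ ks)
far-below l<a a≢ ks<l = ≤∧≢⇒< l<a (λ eq → a≢ (sym eq)) ∷ All.map (λ k<l → ≤-trans (s≤s k<l) l<a) ks<l

Initial-bound : Initial n π → All (λ k → 2 + k ≤ m) (indices π) → Initial m π
Initial-bound []          _        = []
Initial-bound (close _ I) (a≤ ∷ _) = close a≤ I
Initial-bound (wide _ I)  (b≤ ∷ _) = wide b≤ I

-- If the two largest parts are consecutive odd numbers, they form a wide pair and the recursion
-- resumes after both; otherwise the largest part is a run by itself and the next index is lower by
-- at least 2.
initialPairs-initial : ∀ ks → AllPairs _>_ ks →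
  ∃ (λ m → Initial m (initialPairs (map nth-odd ks))) × indices (initialPairs (map nth-odd ks)) ≡ ks
initialPairs-initial [] _ = (0 , []) , refl
initialPairs-initial (a ∷ []) _ rewrite ⌊nth-odd/2⌋ a = (_ , close ≤-refl []) , refl
initialPairs-initial (a ∷ l ∷ ks) ((l<a ∷ _) ∷ ks<l ∷ ap)
  with a ≟ suc l | initialPairs-initial ks ap | initialPairs-initial (l ∷ ks) (ks<l ∷ ap)
... | yes refl | (_ , I) , eq | _ rewrite initialPairs-wide l ks =
  (_ , wide ≤-refl (Initial-bound I (subst (All _) (sym eq) (All.map s≤s ks<l)))) ,
  cong (λ r → suc l ∷ l ∷ r) eq
... | no a≢    | _ | (_ , I) , eq with below ← far-below l<a a≢ ks<l =
  subst (λ π → ∃ (λ m → Initial m π) × indices π ≡ a ∷ l ∷ ks) (sym (initialPairs-close below))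
    ((_ , close ≤-refl (Initial-bound I (subst (All _) (sym eq) below))) , cong (a ∷_) eq)

indices-antitone : Initial m π → AllPairs _>_ (indices π) × All (λ k → 2 + k ≤ m) (indices π)
indices-antitone [] = [] , []
indices-antitone (close a≤ I) with indices-antitone I
... | ap , below = (All.map (≤-trans (n≤1+n _)) below ∷ ap) ,
                   a≤ ∷ All.map (λ k≤ → ≤-trans k≤ (≤-trans (m≤n+m _ 2) a≤)) below
indices-antitone (wide b≤ I) with indices-antitone I
... | ap , below = ((≤-refl ∷ All.map (≤-trans (n≤1+n _)) below) ∷ All.map ≤-pred below ∷ ap) ,
                   b≤ ∷ ≤-trans (n≤1+n _) b≤ ∷ All.map (λ k≤ → ≤-trans k≤ (≤-trans (m≤n+m _ 2) b≤)) below

initialPairs-indices : Initial m π → initialPairs (map nth-odd (indices π)) ≡ π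
initialPairs-indices []          = refl
initialPairs-indices (close _ I) =
  trans (initialPairs-close (proj₂ (indices-antitone I))) (cong (_ ∷_) (initialPairs-indices I))
initialPairs-indices (wide {b = b} {π = π} _ I)  =
  trans (initialPairs-wide b (indices π)) (cong (_ ∷_) (initialPairs-indices I))

indices-length : ∀ π → length (indices π) ≡ widths π
indices-length []            = refl
indices-length (close _ ∷ π) = cong suc (indices-length π)
indices-length (wide _ ∷ π)  = cong (λ k → 2+ k) (indices-length π)

indices-sum : Initial m π → sum (raw (rows π)) ≡ sum (map nth-odd (indices π))
indices-sum [] = refl
indices-sum (close {a = a} _ I) =
  cong suc (trans (sym (+-assoc a a _)) (cong₂ _+_ (sym (double≡+ a)) (indices-sum I)))
indices-sum (wide {b = b} _ I)  = cong (λ r → 3 + double b + (suc (double b) + r)) (indices-sum I)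

-- Multiplicities and the decomposition α² ∘ β

mult-≡ : ∀ i xs → mult i (i ∷ xs) ≡ suc (mult i xs)
mult-≡ i xs = cong length (filter-accept (i ≟_) refl)

mult-≢ : i ≢ j → mult i (j ∷ xs) ≡ mult i xs
mult-≢ i≢j = cong length (filter-reject (_ ≟_) i≢j)

mult-none : All (i ≢_) xs → mult i xs ≡ 0
mult-none i∉ = cong length (filter-none (_ ≟_) i∉)

mult-++ : ∀ i xs ys → mult i (xs ++ ys) ≡ mult i xs + mult i ys
mult-++ i xs ys = trans (cong length (filter-++ (i ≟_) xs ys)) (length-++ (filter (i ≟_) xs))

mult-↭ : ∀ i → xs ↭ ys → mult i xs ≡ mult i ys
mult-↭ i xs↭ys = ↭-length (filter-↭ (i ≟_) xs↭ys)

sorted-≤ : AllPairs _≥_ (j ∷ xs) → mult i (j ∷ xs) ≢ 0 → i ≤ j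
sorted-≤ {j} {i = i} (≤j ∷ _) i∈ = ≮⇒≥ λ j<i →
  i∈ (mult-none ((λ eq → <⇒≢ j<i (sym eq)) ∷ All.map (λ k≤j eq → <⇒≢ (≤-<-trans k≤j j<i) (sym eq)) ≤j))

mult-head : ∀ i xs → mult i (i ∷ xs) ≢ 0
mult-head i xs eq with () ← trans (sym (mult-≡ i xs)) eq

-- Each head occurs in the other list, hence is at most the other head. This reduces all identities
-- between partitions below to counting.
mult-injective : AllPairs _≥_ xs → AllPairs _≥_ ys → (∀ i → mult i xs ≡ mult i ys) → xs ≡ ys
mult-injective {[]}     {[]}     _ _ _ = refl
mult-injective {[]}     {y ∷ ys} _ _ eq = ⊥-elim (mult-head y ys (sym (eq y)))
mult-injective {x ∷ xs} {[]}     _ _ eq = ⊥-elim (mult-head x xs (eq x))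
mult-injective {x ∷ xs} {y ∷ ys} s@(_ ∷ sx) t@(_ ∷ sy) eq with ≤-antisym
  (sorted-≤ t (λ 0≡ → mult-head x xs (trans (eq x) 0≡)))
  (sorted-≤ s (λ 0≡ → mult-head y ys (trans (sym (eq y)) 0≡)))
... | refl = cong (x ∷_) (mult-injective sx sy tails)
  where
  tails : ∀ i → mult i xs ≡ mult i ys
  tails i with i ≟ x
  ... | yes refl = suc-injective (trans (sym (mult-≡ i xs)) (trans (eq i) (mult-≡ i ys)))
  ... | no i≢x   = trans (sym (mult-≢ i≢x)) (trans (eq i) (mult-≢ i≢x))

mult-filter-yes : ∀ {P : Pred ℕ 0ℓ} (P? : ∀ k → Dec (P k)) xs → P i →
                  mult i (filter P? xs) ≡ mult i xs
mult-filter-yes P? [] Pi = refl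
mult-filter-yes {i} P? (x ∷ xs) Pi with i ≟ x | P? x
... | yes refl | no ¬Pi = contradiction Pi ¬Pi
... | yes refl | yes _  = trans (mult-≡ i _) (trans (cong suc (mult-filter-yes P? xs Pi)) (sym (mult-≡ i xs)))
... | no i≢x   | yes _  = trans (mult-≢ i≢x) (trans (mult-filter-yes P? xs Pi) (sym (mult-≢ i≢x)))
... | no i≢x   | no _   = trans (mult-filter-yes P? xs Pi) (sym (mult-≢ i≢x))

mult-filter-no : ∀ {P : Pred ℕ 0ℓ} (P? : ∀ k → Dec (P k)) xs → ¬ P i → mult i (filter P? xs) ≡ 0
mult-filter-no P? xs ¬Pi = mult-none (All.map (λ { Px refl → ¬Pi Px }) (All.all-filter P? xs))

mult-deduplicate : ∀ i xs → mult i (deduplicate _≟_ xs) ≡ 1 ⊓ mult i xs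
mult-deduplicate i []       = refl
mult-deduplicate i (x ∷ xs) with i ≟ x
... | yes refl rewrite mult-≡ i xs =
  trans (mult-≡ i _) (cong suc (mult-filter-no (¬? ∘ (i ≟_)) (deduplicate _≟_ xs) (λ i≢i → i≢i refl)))
... | no i≢x   =
  trans (mult-≢ i≢x) (trans (mult-filter-yes (¬? ∘ (x ≟_)) (deduplicate _≟_ xs) (λ x≡i → i≢x (sym x≡i)))
    (trans (mult-deduplicate i xs) (cong (1 ⊓_) (sym (mult-≢ i≢x)))))

%2-cases : ∀ n → n % 2 ≢ 1 → n % 2 ≡ 0
%2-cases zero          _  = refl
%2-cases (suc zero)    ≢1 = contradiction refl ≢1
%2-cases (suc (suc n)) ≢1 = %2-cases n ≢1

mult-oddMultParts : ∀ i p → mult i (oddMultParts p) ≡ mult i p % 2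
mult-oddMultParts i p with odd? (mult i p)
... | no ¬o = trans (mult-filter-no (λ k → odd? (mult k p)) (deduplicate _≟_ p) ¬o)
                (sym (%2-cases (mult i p) ¬o))
... | yes o = trans (mult-filter-yes (λ k → odd? (mult k p)) (deduplicate _≟_ p) o)
                  (trans (mult-deduplicate i p) (1⊓-odd (mult i p) o))
  where
  1⊓-odd : ∀ n → Odd n → 1 ⊓ n ≡ n % 2
  1⊓-odd (suc n) o = sym o

mult-replicate : ∀ i k → mult i (replicate k i) ≡ k
mult-replicate i zero    = refl
mult-replicate i (suc k) = trans (mult-≡ i _) (cong suc (mult-replicate i k))

mult-replicates : ∀ i (f : ℕ → ℕ) xs → mult i (concatMap (λ j → replicate (f j) j) xs) ≡ mult i xs * f i
mult-replicates i f []       = refl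
mult-replicates i f (x ∷ xs) with i ≟ x
... | yes refl rewrite mult-≡ i xs =
  trans (mult-++ i (replicate (f i) i) _) (cong₂ _+_ (mult-replicate i (f i)) (mult-replicates i f xs))
... | no i≢x =
  trans (mult-++ i (replicate (f x) x) _)
    (trans (cong₂ _+_ (mult-none (All.replicate⁺ (f x) i≢x)) (mult-replicates i f xs))
      (cong (_* f i) (sym (mult-≢ i≢x))))

mult-halfMultParts : ∀ i p → mult i (halfMultParts p) ≡ ⌊ mult i p /2⌋
mult-halfMultParts i p =
  trans (mult-replicates i (λ j → ⌊ mult j p /2⌋) (deduplicate _≟_ p))
    (trans (cong (_* ⌊ mult i p /2⌋) (mult-deduplicate i p)) (1⊓-half (mult i p)))
  where
  1⊓-half : ∀ n → (1 ⊓ n) * ⌊ n /2⌋ ≡ ⌊ n /2⌋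
  1⊓-half zero    = refl
  1⊓-half (suc n) = +-identityʳ _

half-odd : ∀ n → ⌊ n /2⌋ + (⌊ n /2⌋ + n % 2) ≡ n
half-odd zero          = refl
half-odd (suc zero)    = refl
half-odd (suc (suc n)) = cong suc (trans (+-suc ⌊ n /2⌋ _) (cong suc (half-odd n)))

deduplicate-antitone : AllPairs _≥_ xs → AllPairs _>_ (deduplicate _≟_ xs)
deduplicate-antitone [] = []
deduplicate-antitone {x ∷ xs} (≤x ∷ s) =
  All.map (λ { (y≤x , x≢y) → ≤∧≢⇒< y≤x (λ eq → x≢y (sym eq)) })
    (All.zip (All.filter⁺ _ (All.deduplicate⁺ _≟_ ≤x) , All.all-filter (¬? ∘ (x ≟_)) (deduplicate _≟_ xs)))
  ∷ AllPairs.filter⁺ _ (deduplicate-antitone s)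

oddMultParts-antitone : AllPairs _≥_ xs → AllPairs _>_ (oddMultParts xs)
oddMultParts-antitone {xs} s = AllPairs.filter⁺ (λ i → odd? (mult i xs)) (deduplicate-antitone s)

All-replicates : ∀ {P : Pred ℕ 0ℓ} (f : ℕ → ℕ) → All P xs →
                 All P (concatMap (λ j → replicate (f j) j) xs)
All-replicates f []         = []
All-replicates f (px ∷ pxs) = All.++⁺ (All.replicate⁺ (f _) px) (All-replicates f pxs)

replicates-antitone : ∀ (f : ℕ → ℕ) → AllPairs _>_ xs →
                      AllPairs _≥_ (concatMap (λ j → replicate (f j) j) xs)
replicates-antitone f [] = []
replicates-antitone {x ∷ xs} f (<x ∷ s) =
  AllPairs.++⁺ (replicate-antitone (f x)) (replicates-antitone f s)
    (All.replicate⁺ (f x) (All-replicates f (All.map <⇒≤ <x)))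
  where
  replicate-antitone : ∀ k → AllPairs _≥_ (replicate k x)
  replicate-antitone zero    = []
  replicate-antitone (suc k) = All.replicate⁺ k ≤-refl ∷ replicate-antitone k

halfMultParts-antitone : AllPairs _≥_ xs → AllPairs _≥_ (halfMultParts xs)
halfMultParts-antitone {xs} s = replicates-antitone (λ j → ⌊ mult j xs /2⌋) (deduplicate-antitone s)

All-oddMultParts : ∀ {P : Pred ℕ 0ℓ} → All P xs → All P (oddMultParts xs)
All-oddMultParts pxs = All.filter⁺ _ (All.deduplicate⁺ _≟_ pxs)

All-halfMultParts : ∀ {P : Pred ℕ 0ℓ} → All P xs → All P (halfMultParts xs)
All-halfMultParts pxs = All-replicates _ (All.deduplicate⁺ _≟_ pxs)

open Sort (Flip.decTotalOrder ≤-decTotalOrder) using (sort; sort-↭; sort-↗)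


-- The partition α² ∘ β; the sort is with respect to the reversed order.
combine : List ℕ → List ℕ → List ℕ
combine α β = sort (α ++ (α ++ β))

combine-antitone : ∀ α β → AllPairs _≥_ (combine α β)
combine-antitone α β = Linked⇒AllPairs (flip ≤-trans) (sort-↗ (α ++ (α ++ β)))

mult-combine : ∀ i α β → mult i (combine α β) ≡ mult i α + (mult i α + mult i β)
mult-combine i α β =
  trans (mult-↭ i (sort-↭ (α ++ (α ++ β))))
    (trans (mult-++ i α _) (cong (λ k → mult i α + k) (mult-++ i α β)))

All-combine : ∀ {P : Pred ℕ 0ℓ} {α β} → All P α → All P β → All P (combine α β)
All-combine {α = α} {β} pα pβ =
  All-resp-↭ (↭-sym (sort-↭ (α ++ (α ++ β)))) (All.++⁺ pα (All.++⁺ pα pβ))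

combine-parts : ∀ {p} → AllPairs _≥_ p → combine (halfMultParts p) (oddMultParts p) ≡ p
combine-parts {p} s = mult-injective (combine-antitone (halfMultParts p) (oddMultParts p)) s λ i →
  trans (mult-combine i (halfMultParts p) (oddMultParts p))
    (trans (cong₂ (λ h o → h + (h + o)) (mult-halfMultParts i p) (mult-oddMultParts i p))
      (half-odd (mult i p)))

mult-≤1 : AllPairs _>_ xs → mult i xs ≤ 1
mult-≤1 [] = z≤n
mult-≤1 {x ∷ xs} {i = i} (<x ∷ s) with i ≟ x
... | yes refl rewrite mult-≡ i xs | mult-none {xs = xs} (All.map (λ k<i eq → <⇒≢ k<i (sym eq)) <x) =
  ≤-refl
... | no i≢x rewrite mult-≢ {xs = xs} i≢x = mult-≤1 s

-- Uniqueness of the decomposition, for one multiplicity: o ≤ 1 expresses that β has distinct parts.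
halve : ∀ h {o} → o ≤ 1 → ⌊ h + (h + o) /2⌋ ≡ h × (h + (h + o)) % 2 ≡ o
halve zero    z≤n       = refl , refl
halve zero    (s≤s z≤n) = refl , refl
halve (suc h) {o} o≤1 rewrite +-suc h (h + o) = cong suc (proj₁ (halve h o≤1)) , proj₂ (halve h o≤1)

halfMultParts-combine : ∀ {α β} → AllPairs _≥_ α → AllPairs _>_ β → halfMultParts (combine α β) ≡ α
halfMultParts-combine {α} {β} sα sβ =
  mult-injective (halfMultParts-antitone (combine-antitone α β)) sα λ i →
  trans (mult-halfMultParts i (combine α β))
    (trans (cong ⌊_/2⌋ (mult-combine i α β)) (proj₁ (halve (mult i α) (mult-≤1 sβ))))

oddMultParts-combine : ∀ {α β} → AllPairs _>_ β → oddMultParts (combine α β) ≡ β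
oddMultParts-combine {α} {β} sβ =
  mult-injective (AllPairs.map <⇒≤ (oddMultParts-antitone (combine-antitone α β)))
                 (AllPairs.map <⇒≤ sβ) λ i →
  trans (mult-oddMultParts i (combine α β))
    (trans (cong (_% 2) (mult-combine i α β)) (proj₂ (halve (mult i α) (mult-≤1 sβ))))

length-combine : ∀ α β → length (combine α β) ≡ length α + (length α + length β)
length-combine α β =
  trans (↭-length (sort-↭ (α ++ (α ++ β)))) (trans (length-++ α) (cong (λ k → length α + k) (length-++ α)))

sum-combine : ∀ α β → sum (combine α β) ≡ sum α + (sum α + sum β)
sum-combine α β =
  trans (sum-↭ (sort-↭ (α ++ (α ++ β)))) (trans (sum-++ α _) (cong (λ k → sum α + k) (sum-++ α β)))

-- The map Φ

-- The head of `ds` is the last insertion. As Φ inserts in non-increasing order, `ds` is ascending.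
data Built : List ℕ → Rows → Rows → Set where
  []  : Built [] ps ps
  _∷_ : Ins d qs rs → Built ds ps qs → Built (d ∷ ds) ps rs

Built-insertable : Built ds ps rs → All Tight ps → Linked _≤_ (d ∷ ds) → Insertable d rs
Built-insertable []      ts _         = Tight⇒Insertable ts
Built-insertable (i ∷ B) ts (d≤ ∷ L) = Insertable-mono d≤ (Ins-insertable i (Built-insertable B ts L))

Built-decreasing : Built ds ps rs → All Tight ps → Linked _≤_ ds → Decreasing m ps →
                   ∃ λ n → Decreasing n rs
Built-decreasing []      ts _ D = _ , D
Built-decreasing (i ∷ B) ts L D with n , E ← Built-decreasing B ts (Linked.tail L) D =
  -- The bound is enlarged to the maximum of n and 2d + 1 so that it also exceeds 2d.
  _ , Ins-decreasing i (Built-insertable B ts L) (Decreasing-mono (m≤m⊔n n _) E) (m≤n⊔m n _)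

Built-exists : ∀ ds → All Tight ps → Linked _≤_ ds → Decreasing m ps → ∃ (Built ds ps)
Built-exists []       ts L D = _ , []
Built-exists (d ∷ ds) ts L D with qs , B ← Built-exists ds ts (Linked.tail L) D
  with rs , i ← insert-exists d (proj₂ (Built-decreasing B ts (Linked.tail L) D)) = rs , i ∷ B

Built-flat : Built ds ps rs → All Tight ps → Linked _≤_ ds → Decreasing m ps →
             foldr insertAt (flat ps) ds ≡ flat rs
Built-flat []      ts L D = refl
Built-flat (_∷_ {d = d} i B) ts L D =
  trans (cong (insertAt d) (Built-flat B ts (Linked.tail L) D))
    (insertAt-flat i (proj₂ (Built-decreasing B ts (Linked.tail L) D)))

Built-injective : ∀ {ds ds′ ps ps′} → Built ds ps rs → Built ds′ ps′ rs → All Tight ps → All Tight ps′ →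
  Linked _≤_ ds → Linked _≤_ ds′ → ds ≡ ds′ × ps ≡ ps′
Built-injective []      []      _  _   _ _  = refl , refl
Built-injective []      (i ∷ _) ts _   _ _  = ⊥-elim (Ins-not-tight i ts)
Built-injective (i ∷ _) []      _  ts′ _ _  = ⊥-elim (Ins-not-tight i ts′)
Built-injective (i ∷ B) (j ∷ C) ts ts′ L L′
  with refl , refl ← Ins-injective i j (Built-insertable B ts L) (Built-insertable C ts′ L′)
  with refl , refl ← Built-injective B C ts ts′ (Linked.tail L) (Linked.tail L′) = refl , refl

-- The inserted value is itself among those readable off `qs`. Hence insertions undone one after
-- another come out in the required order.
Ins-minimal : Ins e ps qs → Insertable d qs → d ≤ e
Ins-minimal (new eq _)  (tight t ∷ _)        = ⊥-elim (Tight-parity _ t refl eq)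
Ins-minimal (new eq _)  (even k eq′ d≤k ∷ _) =
  ≤-trans d≤k (≤-reflexive (double-injective (trans (sym eq′) eq)))
Ins-minimal (new eq _)  (gap refl _ ∷ _)     = z≤n
Ins-minimal (widen y<x) (tight t ∷ _)        = contradiction (≤-pred (≤-pred (Tight-narrow t))) (<⇒≱ y<x)
Ins-minimal (widen y<x) (even _ _ _ ∷ _)     = contradiction y<x (<-irrefl refl)
Ins-minimal (widen y<x) (gap refl _ ∷ _)     = z≤n
Ins-minimal {d = zero}  (pass _ i) _         = z≤n
Ins-minimal {d = suc d} (pass _ i) (_ ∷ g)   = s≤s (Ins-minimal i g)

Built-linked : Built ds ps rs → Insertable d rs → Linked _≤_ ds → Linked _≤_ (d ∷ ds)
Built-linked []      g L = [-]
Built-linked (i ∷ _) g L = Ins-minimal i g ∷ L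

-- Undoing an insertion lowers the sum, so the process ends, and it ends at tight pairs.
unbuild : Acc _<_ (sum (raw rs)) → Decreasing m rs →
  ∃₂ λ ds ps → Built ds ps rs × All Tight ps × Linked _≤_ ds × ∃ λ n → Decreasing n ps
unbuild {rs} (acc smaller) D with tight-or-inserted D
... | inj₁ ts = [] , rs , [] , ts , [] , _ , D
... | inj₂ (d , qs , i , g , D′)
  with ds , ps , B , ts , L , E ← unbuild (smaller (Ins-sum-< i)) D′ =
  d ∷ ds , ps , i ∷ B , ts , Built-linked B g L , E

Built-altSum : Built ds ps rs → altSum (raw rs) ≡ + (length ds + length ds) ℤ.+ altSum (raw ps)
Built-altSum []                = sym (ℤ.+-identityˡ _)
Built-altSum {ps = ps} (_∷_ {ds = ds} i B) rewrite +-suc (length ds) (length ds) =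
  trans (Ins-altSum i)
    (trans (cong (λ z → + 2 ℤ.+ z) (Built-altSum B))
      (sym (ℤ.+-assoc (+ 2) (+ (length ds + length ds)) (altSum (raw ps)))))

Built-ℓₒ : Built ds ps rs → ℓₒ (raw rs) ≡ ℓₒ (raw ps)
Built-ℓₒ []      = refl
Built-ℓₒ (i ∷ B) = trans (Ins-ℓₒ i) (Built-ℓₒ B)

Built-sum : Built ds ps rs →
            sum (raw rs) ≡ sum (map nth-odd ds) + (sum (map nth-odd ds) + sum (raw ps))
Built-sum []      = refl
Built-sum (_∷_ {d = d} {ds = ds} i B) =
  trans (Ins-sum i)
    (trans (cong₂ _+_ (double≡+ (suc (double d))) (Built-sum B))
      (lem (nth-odd d) (sum (map nth-odd ds)) _))
  where
  lem : ∀ x s r → x + x + (s + (s + r)) ≡ x + s + (x + s + r)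
  lem = solve-∀

-- Runs of Φ on partitions into odd parts

odd-values : All Odd xs → ∃ λ ks → map nth-odd ks ≡ xs
odd-values [] = [] , refl
odd-values {x ∷ _} (ox ∷ oxs) with even-or-odd x | odd-values oxs
... | inj₁ (k , refl) | _         = ⊥-elim (¬Odd-double k ox)
... | inj₂ (k , refl) | ks , refl = k ∷ ks , refl

All-nth-odd : ∀ ks → All Odd (map nth-odd ks)
All-nth-odd []       = []
All-nth-odd (k ∷ ks) = Odd-suc-double k ∷ All-nth-odd ks

nth-odd-≤ : ∀ {j k} → nth-odd j ≤ nth-odd k → j ≤ k
nth-odd-≤ (s≤s le) = double-cancel (m≤n⇒m≤1+n le)

nth-odd-< : ∀ {j k} → nth-odd j < nth-odd k → j < k
nth-odd-< lt = ≤∧≢⇒< (nth-odd-≤ (<⇒≤ lt)) λ { refl → <-irrefl refl lt }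

AllPairs-reverse : ∀ {R : ℕ → ℕ → Set} → AllPairs R xs → AllPairs (flip R) (reverse xs)
AllPairs-reverse [] = []
AllPairs-reverse {x ∷ xs} (rx ∷ rxs) rewrite unfold-reverse x xs =
  AllPairs.++⁺ (AllPairs-reverse rxs) ([] ∷ []) (All.map (_∷ []) (All-resp-↭ (↭-sym (↭-reverse xs)) rx))

-- A run of Φ on p with result γ; steps lists the last insertion first.
record Trace (p γ : List ℕ) : Set where
  field
    {pairs settled}    : List Pair
    {steps}            : List ℕ
    {outcome}          : Rows
    {initialBound}     : ℕ
    oddMultParts≡      : oddMultParts p ≡ map nth-odd (indices pairs)
    halfMultParts≡     : halfMultParts p ≡ map nth-odd (reverse steps)
    initial            : Initial initialBound pairs
    settles            : Settles pairs settled
    ascending          : Linked _≤_ steps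
    built              : Built steps (rows settled) outcome
    result             : γ ≡ flat outcome

  final : Final (pred (double initialBound)) settled
  final = Settles-final initial settles

  settled-tight = Final-tight final

  decreasing : ∃ λ n → Decreasing n outcome
  decreasing = Built-decreasing built settled-tight ascending (Final-decreasing final)

open Trace

⌊double/2⌋ : ∀ k → ⌊ double k /2⌋ ≡ k
⌊double/2⌋ zero    = refl
⌊double/2⌋ (suc k) = cong suc (⌊double/2⌋ k)

foldl-insert : ∀ γ ks →
  foldl (λ γ x → insert ⌈ x /2⌉ γ) γ (map nth-odd ks) ≡ foldl (flip insertAt) γ ks
foldl-insert γ []       = refl
foldl-insert γ (k ∷ ks) rewrite ⌊double/2⌋ k = foldl-insert (insertAt k γ) ks

Trace-Φ : ∀ {p γ} → Trace p γ → Φ p ≡ γ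
Trace-Φ {p} t rewrite oddMultParts≡ t | halfMultParts≡ t =
  trans (foldl-insert _ (reverse (steps t)))
    -- Φ folds from the left over the largest parts first; with the last insertion listed first this
    -- becomes the right fold of `Built-flat`.
    (trans (reverse-foldl (flip insertAt) _ (steps t))
      (trans (cong (λ γ → foldr insertAt γ (steps t)) bressoud≡)
        (trans (Built-flat (built t) (settled-tight t) (ascending t) (Final-decreasing (final t)))
          (sym (result t)))))
  where
  bressoud≡ : bressoud (map nth-odd (indices (pairs t))) ≡ flat (rows (settled t))
  bressoud≡ = trans (bressoud-rows (map nth-odd (indices (pairs t)))) (cong (flat ∘ rows)
    (trans (cong normalise (initialPairs-indices (initial t)))
      (Settles-deterministic (normalise-settles (pairs t)) (settles t))))

Trace-exists : ∀ {p} → AllPairs _≥_ p → All Odd p → ∃ (Trace p)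
Trace-exists {p} s odds
  with ks , eq-ks ← odd-values (All-oddMultParts odds)
     | as , eq-as ← odd-values (All-halfMultParts odds)
  with (_ , I) , eq ← initialPairs-initial ks
         (AllPairs.map nth-odd-< (AllPairs.map⁻ (subst (AllPairs _>_) (sym eq-ks) (oddMultParts-antitone s))))
  with L ← AllPairs⇒Linked (AllPairs-reverse
         (AllPairs.map nth-odd-≤ (AllPairs.map⁻ (subst (AllPairs _≥_) (sym eq-as) (halfMultParts-antitone s)))))
  with S ← normalise-settles (initialPairs (map nth-odd ks))
  with F ← Settles-final I S
  with rs , B ← Built-exists (reverse as) (Final-tight F) L (Final-decreasing F) =
  flat rs , record
    { oddMultParts≡ = trans (sym eq-ks) (cong (map nth-odd) (sym eq))
    ; halfMultParts≡ = trans (sym eq-as) (cong (map nth-odd) (sym (reverse-involutive as)))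
    ; initial = I ; settles = S ; ascending = L ; built = B ; result = refl }

-- The stages are peeled off from the end: zero entries, insertions, rows, settling; then α and β
-- agree, and with them p and q.
Trace-injective : ∀ {p q γ} → AllPairs _≥_ p → AllPairs _≥_ q → Trace p γ → Trace q γ → p ≡ q
Trace-injective sp sq t u
  with outcome≡ ← flat-injective (proj₂ (decreasing u)) (proj₂ (decreasing t))
                    (trans (sym (result u)) (result t))
  with refl , eq ← Built-injective (built t) (subst (Built _ _) outcome≡ (built u))
                     (settled-tight t) (settled-tight u) (ascending t) (ascending u)
  with refl ← rows-injective (final t) (final u) eq
  with refl ← Settles-injective (initial t) (initial u) (settles t) (settles u) =
  trans (sym (combine-parts sp))
    (trans (cong₂ combine (trans (halfMultParts≡ t) (sym (halfMultParts≡ u)))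
                          (trans (oddMultParts≡ t) (sym (oddMultParts≡ u))))
      (combine-parts sq))

source : List ℕ → List Pair → List ℕ
source ds π = combine (map nth-odd (reverse ds)) (map nth-odd (indices π))

source-antitone : ∀ ds π → AllPairs _≥_ (source ds π)
source-antitone ds π = combine-antitone (map nth-odd (reverse ds)) (map nth-odd (indices π))

source-odd : ∀ ds π → All Odd (source ds π)
source-odd ds π = All-combine (All-nth-odd (reverse ds)) (All-nth-odd (indices π))

source-trace : Linked _≤_ ds → Initial m π → Settles π ρ → Built ds (rows ρ) rs →
               Trace (source ds π) (flat rs)
source-trace {ds} {π = π} L I S B = record
  { oddMultParts≡  = oddMultParts-combine {map nth-odd (reverse ds)} distinct
  ; halfMultParts≡ = halfMultParts-combine weak distinct
  ; initial = I ; settles = S ; ascending = L ; built = B ; result = refl }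
  where
  distinct : AllPairs _>_ (map nth-odd (indices π))
  distinct = AllPairs.map⁺
    (AllPairs.map (λ lt → s≤s (≤-trans (n≤1+n _) (double-mono lt))) (proj₁ (indices-antitone I)))
  weak : AllPairs _≥_ (map nth-odd (reverse ds))
  weak = AllPairs.map⁺ (AllPairs.map (s≤s ∘ double-mono) (AllPairs-reverse (Linked⇒AllPairs ≤-trans L)))

All-<-sum : ∀ xs → All (_< suc (sum xs)) xs
All-<-sum []       = []
All-<-sum (x ∷ xs) = s≤s (m≤m+n x _) ∷ All.map (λ le → ≤-trans le (s≤s (m≤n+m _ x))) (All-<-sum xs)

Trace-surjective : ∀ {γ} → AllPairs _>_ γ → All (0 <_) γ →
                   ∃ λ p → AllPairs _≥_ p × All Odd p × Trace p γ
Trace-surjective {γ} s pos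
  with rs , D , refl ← unflatten s pos (All-<-sum γ)
  with ds , ps , B , ts , L , _ , E ← unbuild (<-wellFounded _) D
  with ρ , F , refl ← Tight-final ts E
  with _ , π , I , S ← unsettle _ refl F =
  source ds π , source-antitone ds π , source-odd ds π , source-trace L I S B

module _ {p γ : List ℕ} (s : AllPairs _≥_ p) (t : Trace p γ) where

  length-odd : nₒ p ≡ widths (pairs t)
  length-odd = trans (cong length (oddMultParts≡ t))
    (trans (length-map nth-odd (indices (pairs t))) (indices-length (pairs t)))

  length-trace : length p ≡ length (steps t) + (length (steps t) + widths (pairs t))
  length-trace = trans (cong length (sym (combine-parts s)))
    (trans (length-combine (halfMultParts p) (oddMultParts p))
      (cong₂ (λ h o → h + (h + o)) length-half length-odd))
    where
    length-half = trans (cong length (halfMultParts≡ t))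
                    (trans (length-map nth-odd (reverse (steps t))) (length-reverse (steps t)))

  sum-trace : sum γ ≡ sum p
  sum-trace =
    trans (cong sum (result t)) (trans (sum-positive (raw (outcome t))) (trans (Built-sum (built t))
      (trans (cong₂ (λ a b → a + (a + b)) sum-half sum-odd)
        (trans (sym (sum-combine (halfMultParts p) (oddMultParts p))) (cong sum (combine-parts s))))))
    where
    sum-half = trans (sum-↭ (map⁺ nth-odd (↭-sym (↭-reverse (steps t)))))
                 (cong sum (sym (halfMultParts≡ t)))
    sum-odd  = trans (Settles-sum (initial t) (settles t))
                 (trans (indices-sum (initial t)) (cong sum (sym (oddMultParts≡ t))))

  altSum-trace : altSum γ ≡ + length p
  altSum-trace = begin
    altSum γ                                          ≡⟨ cong altSum (result t) ⟩
    altSum (flat (outcome t))                         ≡⟨ altSum-flat (proj₂ (decreasing t)) ⟩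
    altSum (raw (outcome t))                          ≡⟨ Built-altSum (built t) ⟩
    + (k + k) ℤ.+ altSum (raw (rows (settled t)))     ≡⟨ cong (λ z → + (k + k) ℤ.+ z) (Final-altSum (final t)) ⟩
    + (k + k + widths (settled t))                    ≡⟨ cong (λ w → + (k + k + w)) (Settles-widths (settles t)) ⟩
    + (k + k + widths (pairs t))                      ≡⟨ cong +_ (trans (+-assoc k k _) (sym length-trace)) ⟩
    + length p                                        ∎
    where
    open ≡-Reasoning
    k = length (steps t)

  ℓₒ-trace : ℓₒ γ ≡ nₒ p
  ℓₒ-trace = begin
    ℓₒ γ                                      ≡⟨ cong ℓₒ (result t) ⟩
    ℓₒ (flat (outcome t))                     ≡⟨ ℓₒ-positive (raw (outcome t)) ⟩
    ℓₒ (raw (outcome t))                      ≡⟨ Built-ℓₒ (built t) ⟩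
    ℓₒ (raw (rows (settled t)))               ≡⟨ Final-ℓₒ (final t) ⟩
    widths (settled t)                        ≡⟨ Settles-widths (settles t) ⟩
    widths (pairs t)                          ≡⟨ length-odd ⟨
    nₒ p                                      ∎
    where open ≡-Reasoning

  γ-antitone : AllPairs _>_ γ
  γ-antitone = subst (AllPairs _>_) (sym (result t)) (flat-antitone (proj₂ (decreasing t)))

  γ-positive : All (0 <_) γ
  γ-positive = subst (All (0 <_)) (sym (result t)) (flat-positive (outcome t))

-- The bijection between 𝒪(n) and 𝒟(n)

𝒪-antitone : ∀ {p} → p ∈ 𝒪 n → AllPairs _≥_ p
𝒪-antitone (isP , _) = Linked⇒AllPairs (flip ≤-trans) (IsPartition.nonIncreasing isP)

𝒟-antitone : ∀ {p} → p ∈ 𝒟 n → AllPairs _>_ p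
𝒟-antitone (isP , u) = AllPairs.zipWith (λ (ge , ne) → ≤∧≢⇒< ge (λ eq → ne (sym eq)))
  (Linked⇒AllPairs (flip ≤-trans) (IsPartition.nonIncreasing isP) , u)

trace : ∀ {p} → p ∈ 𝒪 n → Trace p (Φ p)
trace {p = p} p∈ with γ , t ← Trace-exists (𝒪-antitone p∈) (proj₂ p∈) =
  subst (Trace p) (sym (Trace-Φ t)) t

Φ-𝒟 : ∀ p → p ∈ 𝒪 n → Φ p ∈ 𝒟 n
Φ-𝒟 p p∈ = record
  { nonIncreasing = AllPairs⇒Linked (AllPairs.map <⇒≤ ap)
  ; positive      = γ-positive s t
  ; total         = trans (sum-trace s t) (IsPartition.total (proj₁ p∈)) } ,
  AllPairs.map (λ y<x eq → <⇒≢ y<x (sym eq)) ap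
  where
  s = 𝒪-antitone p∈
  t = trace p∈
  ap = γ-antitone s t

-- Distinct parts mean that p is α² ∘ β with α empty and β = p, so the fold of insertions is empty.
Φ-bressoud : ∀ p → p ∈ 𝒪 n → p ∈ 𝒟 n → Φ p ≡ bressoud p
Φ-bressoud p p∈𝒪 p∈𝒟 = cong₂ (λ α β → foldl (λ γ x → insert ⌈ x /2⌉ γ) (bressoud β) α)
  (trans (cong halfMultParts (sym p≡)) (halfMultParts-combine [] s>))
  (trans (cong oddMultParts (sym p≡)) (oddMultParts-combine {[]} s>))
  where
  s> = 𝒟-antitone p∈𝒟
  p≡ : combine [] p ≡ p
  p≡ = mult-injective (combine-antitone [] p) (𝒪-antitone p∈𝒪) λ i → mult-combine i [] p

mainTheorem2 : (n : ℕ) → 0 < n →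
    (Σ[ maps ∈ (∀ p → p ∈ 𝒪 n → Φ p ∈ 𝒟 n) ]
    Bijective {A = ∃ (𝒪 n)} {B = ∃ (𝒟 n)} (_≡_ on proj₁) (_≡_ on proj₁)
    (λ (p , p∈𝒪) → Φ p , maps p p∈𝒪))
    × (∀ p → p ∈ 𝒪 n → p ∈ 𝒟 n → Φ p ≡ bressoud p)
    × (∀ p → p ∈ 𝒪 n → (altSum (Φ p) ≡ + (length p)) × (ℓₒ (Φ p) ≡ nₒ p))
mainTheorem2 n _ = (Φ-𝒟 , (λ {p} {q} → injective {p} {q}) , surjective) , Φ-bressoud , λ p p∈ →
  altSum-trace (𝒪-antitone p∈) (trace p∈) , ℓₒ-trace (𝒪-antitone p∈) (trace p∈)
  where
  injective : ∀ {p q : ∃ (𝒪 n)} → Φ (proj₁ p) ≡ Φ (proj₁ q) → proj₁ p ≡ proj₁ q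
  injective {p , p∈} {q , q∈} eq =
    Trace-injective (𝒪-antitone p∈) (𝒪-antitone q∈) (trace p∈) (subst (Trace q) (sym eq) (trace q∈))

  surjective : ∀ (γ : ∃ (𝒟 n)) → ∃ λ (p : ∃ (𝒪 n)) → ∀ {q : ∃ (𝒪 n)} →
               proj₁ q ≡ proj₁ p → Φ (proj₁ q) ≡ proj₁ γ
  surjective (γ , γ∈)
    with p , s , odds , t ← Trace-surjective (𝒟-antitone γ∈) (IsPartition.positive (proj₁ γ∈)) =
    (p , record
      { nonIncreasing = AllPairs⇒Linked s
      ; positive      = All.map Odd-positive odds
      ; total         = trans (sym (sum-trace s t)) (IsPartition.total (proj₁ γ∈)) } , odds) ,
    λ eq → trans (cong Φ eq) (Trace-Φ t)
    where
    Odd-positive : ∀ {k} → Odd k → 0 < k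
    Odd-positive {suc k} _ = s≤s z≤n
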